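{- Let $q$ be a prime power and let $L$ be a line of $\mathrm{PG}(5,q)$ in the $K$-orbit $o_9$. Then the hyperplane-orbit distribution of $L$ is $OD_4(L)=[1,\,q^2+q,\,0,\,q^3]$.
   Context: A point $(y_0,\dots,y_5)$ of $\mathrm{PG}(5,q)$ is identified with the nonzero symmetric matrix $\begin{bmatrix} y_0&y_1&y_2\\ y_1&y_3&y_4\\ y_2&y_4&y_5\end{bmatrix}$ up to scalar. $K\cong\mathrm{PGL}(3,q)$ acts by $M\mapsto AMA^T$, $A\in\mathrm{GL}(3,q)$. The orbit $o_9$ is the $K$-orbit of the line $\left\{\begin{bmatrix} x&0&y\\ 0&y&0\\ y&0&0\end{bmatrix}:(x,y)\in\mathrm{PG}(1,q)\right\}$. Hyperplanes correspond to conics of $\mathrm{PG}(2,q)$ (nonzero quadratic forms up to scalar): $\sum_{0\le i\le j\le2}a_{ij}X_iX_j$ corresponds to $a_{00}Y_0+a_{01}Y_1+a_{02}Y_2+a_{11}Y_3+a_{12}Y_4+a_{22}Y_5=0$. $\mathcal H_1,\mathcal H_{2,r},\mathcal H_{2,i},\mathcal H_3$ are the sets of hyperplanes corresponding respectively to double lines (scalar multiples of squares of linear forms), pairs of distinct real lines (products of two non-proportional linear forms over $\mathbb F_q$), pairs of conjugate imaginary lines (scalar multiples of products of two non-proportional linear forms conjugate over $\mathbb F_{q^2}$), and non-singular conics (those with $4a_{00}a_{11}a_{22}+a_{01}a_{02}a_{12}-a_{00}a_{12}^2-a_{11}a_{02}^2-a_{22}a_{01}^2\ne0$). $OD_4(L)=[h_1,h_{2,r},h_{2,i},h_3]$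 lists the numbers of hyperplanes in $\mathcal H_1,\mathcal H_{2,r},\mathcal H_{2,i},\mathcal H_3$ containing $L$. -}

module Defs where

open import Level using (Level; _⊔_; suc)
open import Algebra.Bundles using (CommutativeRing)
open import Algebra.Morphism.Structures using (IsRingHomomorphism; IsRingIsomorphism)
import Algebra.Definitions.RawMonoid as RawMonoidDefs
open import Data.Bool.Base using (if_then_else_)
open import Data.Fin.Base using (Fin)
open import Data.Fin.Patterns using (0F; 1F; 2F; 3F; 4F; 5F)
open import Data.Fin.Properties using (_≟_)
open import Data.Nat.Base as ℕ using (ℕ; NonZero)
open import Data.Nat.Primality using (Prime)
open import Data.Product.Base using (Σ; ∃; ∃₂; _×_; _,_; proj₁)
import Data.Vec.Base as Vec
open import Data.Vec.Functional using (Vector; _∷_; []; transpose; map)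
import Data.Vec.Functional.Relation.Binary.Equality.Setoid as VectorEquality
open import Function.Base using (_∘_)
open import Function.Bundles using (Inverse)
open import Relation.Binary.Bundles using (Setoid)
import Relation.Binary.Construct.On as On
open import Relation.Binary.PropositionalEquality using (_≡_)
import Relation.Binary.PropositionalEquality as ≡
open import Relation.Nullary.Decidable using (does)
open import Relation.Nullary.Negation using (¬_)
open import Relation.Unary using (Pred; _≐_; _∩_)

private
  variable
    c ℓ p : Level

IsPrimePower : ℕ → Set
IsPrimePower q = ∃₂ λ p n → Prime p × NonZero n × q ≡ p ℕ.^ n

HasCardinality : Setoid c ℓ → ℕ → Set (c ⊔ ℓ)
HasCardinality S n = Inverse S (≡.setoid (Fin n))

-- Classical fields. The library's HeytingField carries a separate apartness
-- relation, which is redundant for the finite fields used here: a bijection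
-- with Fin q makes _≈_ decidable.
record Field c ℓ : Set (suc (c ⊔ ℓ)) where
  field
    commutativeRing : CommutativeRing c ℓ

  open CommutativeRing commutativeRing public

  field
    1≉0     : ¬ 1# ≈ 0#
    inverse : ∀ x → ¬ x ≈ 0# → ∃ λ y → x * y ≈ 1#

HasOrder : Field c ℓ → ℕ → Set (c ⊔ ℓ)
HasOrder F = HasCardinality (Field.setoid F)

module Coordinates (F : Field c ℓ) where
  open Field F
  open RawMonoidDefs +-rawMonoid public using (sum) renaming (_×_ to _×ₙ_)
  open VectorEquality setoid public using (_≋_)

  infixr 7 _·_
  infixl 6 _⊕_
  infix  4 _∝_

  _·_ : ∀ {n} → Carrier → Vector Carrier n → Vector Carrier n
  (k · v) i = k * v i

  _⊕_ : ∀ {n} → Vector Carrier n → Vector Carrier n → Vector Carrier n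
  (u ⊕ v) i = u i + v i

  IsZero : ∀ {n} → Pred (Vector Carrier n) ℓ
  IsZero v = ∀ i → v i ≈ 0#

  _∝_ : ∀ {n} → Vector Carrier n → Vector Carrier n → Set (c ⊔ ℓ)
  u ∝ v = ∃ λ k → ¬ k ≈ 0# × u ≋ k · v

  ∝-refl : ∀ {n} {u : Vector Carrier n} → u ∝ u
  ∝-refl = 1# , 1≉0 , λ i → sym (*-identityˡ _)

  ∝-sym : ∀ {n} {u v : Vector Carrier n} → u ∝ v → v ∝ u
  ∝-sym (k , k≉0 , u≋kv) with inverse k k≉0
  ... | k⁻¹ , kk⁻¹≈1 =
    k⁻¹
    , (λ k⁻¹≈0 → 1≉0 (trans (sym kk⁻¹≈1) (trans (*-congˡ k⁻¹≈0) (zeroʳ k))))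
    , λ i → sym (trans (*-congˡ (u≋kv i))
                (trans (sym (*-assoc _ _ _))
                (trans (*-congʳ (trans (*-comm k⁻¹ k) kk⁻¹≈1))
                       (*-identityˡ _))))

  ∝-trans : ∀ {n} {u v w : Vector Carrier n} → u ∝ v → v ∝ w → u ∝ w
  ∝-trans (k , k≉0 , u≋kv) (m , m≉0 , v≋mw) =
    k * m , km≉0
    , λ i → trans (u≋kv i) (trans (*-congˡ (v≋mw i)) (sym (*-assoc _ _ _)))
    where
    km≉0 : ¬ k * m ≈ 0#
    km≉0 km≈0 with inverse k k≉0
    ... | k⁻¹ , kk⁻¹≈1 = m≉0
      (trans (sym (*-identityˡ m))
      (trans (*-congʳ (trans (sym kk⁻¹≈1) (*-comm k k⁻¹)))
      (trans (*-assoc _ _ _) (trans (*-congˡ km≈0) (zeroʳ k⁻¹)))))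

  LinearForm : Set c
  LinearForm = Vector Carrier 3

  -- Coefficients a₀₀, a₀₁, a₀₂, a₁₁, a₁₂, a₂₂, in this order.
  QuadraticForm : Set c
  QuadraticForm = Vector Carrier 6

  infixl 7 _⊙_

  _⊙_ : LinearForm → LinearForm → QuadraticForm
  l ⊙ m =
      l 0F * m 0F
    ∷ l 0F * m 1F + l 1F * m 0F
    ∷ l 0F * m 2F + l 2F * m 0F
    ∷ l 1F * m 1F
    ∷ l 1F * m 2F + l 2F * m 1F
    ∷ l 2F * m 2F
    ∷ []

module Projective (F : Field c ℓ) where
  open Field F
  open Coordinates F

  -- Points are represented by homogeneous coordinates; two representatives
  -- are equal in PG when they are proportional.
  record Point (n : ℕ) : Set (c ⊔ ℓ) where
    field
      coord   : Vector Carrier (ℕ.suc n)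
      nonzero : ¬ IsZero coord

  open Point public

  PG : ℕ → Setoid (c ⊔ ℓ) (c ⊔ ℓ)
  PG n = record
    { Carrier       = Point n
    ; _≈_           = λ P Q → coord P ∝ coord Q
    ; isEquivalence = record { refl = ∝-refl ; sym = ∝-sym ; trans = ∝-trans }
    }

  record Line (n : ℕ) : Set (c ⊔ ℓ) where
    field
      P Q : Point n
      P≉Q : ¬ coord P ∝ coord Q

  points : ∀ {n} → Line n → Pred (Point n) (c ⊔ ℓ)
  points L R = ∃₂ λ s t → coord R ≋ s · coord (Line.P L) ⊕ t · coord (Line.Q L)

  -- A hyperplane is given by its (dual) homogeneous coordinates.
  Hyperplane : ℕ → Set (c ⊔ ℓ)
  Hyperplane = Point

  infix 4 _∈ₕ_

  _∈ₕ_ : ∀ {n} → Point n → Hyperplane n → Set ℓ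
  R ∈ₕ H = sum (λ i → coord H i * coord R i) ≈ 0#

  Contains : ∀ {n} → Line n → Pred (Hyperplane n) (c ⊔ ℓ)
  Contains L H = ∀ R → points L R → R ∈ₕ H

  -- Hyperplanes are counted up to proportionality.
  CountHyperplanes : ∀ {n} → Pred (Hyperplane n) p → ℕ → Set (c ⊔ ℓ ⊔ p)
  CountHyperplanes {n = n} 𝓗 = HasCardinality (On.setoid (PG n) (proj₁ {B = 𝓗}))

module SymmetricMatrices (F : Field c ℓ) where
  open Field F
  open Coordinates F
  open Projective F

  Matrix : Set c
  Matrix = Vector (Vector Carrier 3) 3

  infix  4 _≈ᴹ_
  infixl 7 _*ᴹ_

  _≈ᴹ_ : Matrix → Matrix → Set ℓ
  A ≈ᴹ B = ∀ i j → A i j ≈ B i j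

  _*ᴹ_ : Matrix → Matrix → Matrix
  (A *ᴹ B) i j = sum (λ k → A i k * B k j)

  1ᴹ : Matrix
  1ᴹ i j = if does (i ≟ j) then 1# else 0#

  record GL₃ : Set (c ⊔ ℓ) where
    field
      matrix matrix⁻¹ : Matrix
      inverseˡ        : matrix⁻¹ *ᴹ matrix ≈ᴹ 1ᴹ
      inverseʳ        : matrix *ᴹ matrix⁻¹ ≈ᴹ 1ᴹ

  toMatrix : Vector Carrier 6 → Matrix
  toMatrix y =
      (y 0F ∷ y 1F ∷ y 2F ∷ [])
    ∷ (y 1F ∷ y 3F ∷ y 4F ∷ [])
    ∷ (y 2F ∷ y 4F ∷ y 5F ∷ [])
    ∷ []

  -- The image of a set of points under M ↦ A M Aᵀ; the scalar k makes it
  -- independent of the choice of homogeneous coordinates.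
  image : GL₃ → Pred (Point 5) p → Pred (Point 5) (c ⊔ ℓ ⊔ p)
  image A S R = ∃ λ R′ → S R′ × ∃ λ k → ¬ k ≈ 0# ×
    toMatrix (coord R) ≈ᴹ map (k ·_) (g *ᴹ toMatrix (coord R′) *ᴹ transpose g)
    where g = GL₃.matrix A

  -- (x , y) ≠ (0 , 0) is automatic, since coord R is nonzero.
  ℓ₉ : Pred (Point 5) (c ⊔ ℓ)
  ℓ₉ R = ∃₂ λ x y → toMatrix (coord R) ≈ᴹ
      (x  ∷ 0# ∷ y  ∷ [])
    ∷ (0# ∷ y  ∷ 0# ∷ [])
    ∷ (y  ∷ 0# ∷ 0# ∷ [])
    ∷ []

  o₉ : Pred (Line 5) (c ⊔ ℓ)
  o₉ L = ∃ λ A → points L ≐ image A ℓ₉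

-- Any two such extensions of a finite field of order q are isomorphic, so
-- this is the embedding of 𝔽_q in 𝔽_{q²}.
record QuadraticExtension (F : Field c ℓ) (q : ℕ) c′ ℓ′ :
                          Set (c ⊔ ℓ ⊔ suc (c′ ⊔ ℓ′)) where
  field
    E                : Field c′ ℓ′
    order            : HasOrder E (q ℕ.^ 2)
    ι                : Field.Carrier F → Field.Carrier E
    isHomomorphism   : IsRingHomomorphism (Field.rawRing F) (Field.rawRing E) ι

module Hyperplanes {q : ℕ} {c′ ℓ′} (F : Field c ℓ)
                   (E/F : QuadraticExtension F q c′ ℓ′) where
  open Field F
  open Coordinates F
  open Projective F
  open QuadraticExtension E/F using (E; ι)
  private
    module E = Field E
    module CE = Coordinates E

  -- m = σ(l) for some σ in Gal(E/F).
  Conjugate : CE.LinearForm → CE.LinearForm → Set (c ⊔ c′ ⊔ ℓ′)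
  Conjugate l m = ∃ λ σ → IsRingIsomorphism E.rawRing E.rawRing σ
                        × (∀ x → σ (ι x) E.≈ ι x)
                        × m CE.≋ map σ l

  -- The coordinates of a hyperplane of PG(5,q) are the coefficients of the
  -- quadratic form of the corresponding conic, in the same order.

  𝓗₁ : Pred (Hyperplane 5) (c ⊔ ℓ)
  𝓗₁ H = ∃₂ λ k l → coord H ≋ k · (l ⊙ l)

  𝓗₂ᵣ : Pred (Hyperplane 5) (c ⊔ ℓ)
  𝓗₂ᵣ H = ∃₂ λ l m → ¬ l ∝ m × coord H ≋ l ⊙ m

  𝓗₂ᵢ : Pred (Hyperplane 5) (c ⊔ c′ ⊔ ℓ′)
  𝓗₂ᵢ H = ∃ λ k → ∃₂ λ l m → Conjugate l m × ¬ l CE.∝ m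
                           × map ι (coord H) CE.≋ ι k CE.· (l CE.⊙ m)

  Δ : QuadraticForm → Carrier
  Δ a = 4 ×ₙ (a₀₀ * a₁₁ * a₂₂) + a₀₁ * a₀₂ * a₁₂
        - a₀₀ * (a₁₂ * a₁₂) - a₁₁ * (a₀₂ * a₀₂) - a₂₂ * (a₀₁ * a₀₁)
    where
    a₀₀ = a 0F
    a₀₁ = a 1F
    a₀₂ = a 2F
    a₁₁ = a 3F
    a₁₂ = a 4F
    a₂₂ = a 5F

  𝓗₃ : Pred (Hyperplane 5) ℓ
  𝓗₃ H = ¬ Δ (coord H) ≈ 0#

  HasOD₄ : Line 5 → Vec.Vec ℕ 4 → Set (c ⊔ ℓ ⊔ c′ ⊔ ℓ′)
  HasOD₄ L (h₁ Vec.∷ h₂ᵣ Vec.∷ h₂ᵢ Vec.∷ h₃ Vec.∷ Vec.[]) =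
      CountHyperplanes (𝓗₁  ∩ Contains L) h₁
    × CountHyperplanes (𝓗₂ᵣ ∩ Contains L) h₂ᵣ
    × CountHyperplanes (𝓗₂ᵢ ∩ Contains L) h₂ᵢ
    × CountHyperplanes (𝓗₃  ∩ Contains L) h₃

module Submission where

-- Substituting Σⱼ Aᵢⱼ Xⱼ for Xᵢ in quadratic forms is adjoint to M ↦ A M Aᵀ on points,
-- and it preserves each of the four classes of conics, Δ being multiplied by
-- det(A)². So the line may be taken to be ℓ₉ itself: the hyperplanes through it
-- form the net with a₀₀ = 0 and a₀₂ + a₁₁ = 0, that is, the conics
--   b X₀X₁ + c (X₀X₂ − X₁²) + d X₁X₂ + e X₂²,  Δ = b c d + c³ − e b².
-- Scaling the first nonzero coefficient to 1:
--   (1, c, d, e): Δ = c d + c³ − e; if Δ = 0 the conic is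
--                 (X₁ + c X₂)(X₀ − c X₁ + (d + c²) X₂);
--   (0, 1, d, e): Δ = 1;
--   (0, 0, 1, e): the real line pair X₂ (X₁ + e X₂);
--   (0, 0, 0, 1): the double line X₂².
-- If k l σ(l) is in the net, then a₀₀ = 0 gives l₀ = 0, hence a₀₂ = 0 = a₁₁ and
-- l₁ = 0, so that l and σ(l) are proportional.

open import Defs
open import Level using (Level; _⊔_)
open import Algebra.Bundles using (CommutativeRing; RawRing)
import Algebra.Definitions.RawMonoid as RawMonoidDefs
open import Algebra.Morphism.Structures using (IsRingHomomorphism; IsRingIsomorphism)
import Algebra.Solver.Ring
open import Algebra.Solver.Ring.AlmostCommutativeRing
  using (fromCommutativeRing; _-Raw-AlmostCommutative⟶_)
open import Data.Fin.Base as Fin using (Fin; _↑ˡ_; _↑ʳ_; combine)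
open import Data.Fin.Patterns using (0F; 1F; 2F; 3F; 4F; 5F)
import Data.Fin.Properties as Fin
open import Data.Integer.Base as ℤ using (ℤ; +_; -[1+_])
import Data.Integer.Properties as ℤ
import Data.Maybe.Base as Maybe
open import Data.Nat.Base as ℕ using (ℕ; zero; suc)
import Data.Nat.Properties as ℕ
open import Data.Product.Base using (∃; ∃₂; _×_; _,_; proj₁; proj₂)
open import Data.Product.Function.NonDependent.Setoid using (_×-inverse_)
open import Data.Product.Relation.Binary.Pointwise.NonDependent using (_×ₛ_)
  renaming (Pointwise-≡↔≡ to ×-Pointwise-≡↔≡)
open import Data.Sum.Base using (_⊎_; inj₁; inj₂; [_,_]′)
open import Data.Sum.Function.Setoid using (_⊎-inverse_)
open import Data.Sum.Relation.Binary.Pointwise using (_⊎ₛ_; inj₁; inj₂)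
  renaming (Pointwise-≡↔≡ to ⊎-Pointwise-≡↔≡)
import Data.Vec.Base as Vec
import Data.Vec.Functional as Functional
open import Data.Vec.Functional using (Vector; map; _++_; concat; transpose)
open import Data.Vec.Relation.Binary.Pointwise.Inductive
  using (Pointwise; ≡⇒Pointwise-≡; tabulate⁺; tabulate⁻)
open import Function.Base using (_∘_; id)
open import Function.Bundles using (Bijection)
import Function.Construct.Composition as Composition
import Function.Construct.Identity as Identity
import Function.Construct.Symmetry as Symmetry
open import Function.Properties.Bijection using (Bijection⇒Inverse)
open import Function.Properties.Inverse using (Inverse⇒Injection)
open import Relation.Binary.Bundles using (Setoid)
import Relation.Binary.Construct.On as On
open import Relation.Binary.Definitions using (Decidable)
open import Relation.Binary.PropositionalEquality as ≡ using (_≡_)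
open import Relation.Nullary.Decidable
  using (Dec; yes; no; dec⇒maybe; decidable-stable; via-injection)
open import Relation.Nullary.Negation using (¬_; contradiction)
open import Relation.Unary using (Pred; _∩_; _≐_)

private
  variable
    a b c ℓ c′ ℓ′ p t : Level

-- Cardinalities of products, sums and empty setoids.

module _ {S : Setoid a ℓ} {T : Setoid b t} {m n : ℕ} where

  ×-cardinality : HasCardinality S m → HasCardinality T n → HasCardinality (S ×ₛ T) (m ℕ.* n)
  ×-cardinality f g = Composition.inverse (f ×-inverse g)
    (Composition.inverse ×-Pointwise-≡↔≡ (Symmetry.inverse Fin.*↔×))

  ⊎-cardinality : HasCardinality S m → HasCardinality T n → HasCardinality (S ⊎ₛ T) (m ℕ.+ n)
  ⊎-cardinality f g = Composition.inverse (f ⊎-inverse g)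
    (Composition.inverse (⊎-Pointwise-≡↔≡ _ _) (Symmetry.inverse Fin.+↔⊎))

cardinality⇒decidable : {S : Setoid a ℓ} {n : ℕ} → HasCardinality S n → Decidable (Setoid._≈_ S)
cardinality⇒decidable f = via-injection (Inverse⇒Injection f) Fin._≟_

empty-cardinality : {S : Setoid a ℓ} → ¬ Setoid.Carrier S → HasCardinality S 0
empty-cardinality S-empty = record
  { to        = λ x → contradiction x S-empty
  ; from      = λ ()
  ; to-cong   = λ {x} → contradiction x S-empty
  ; from-cong = λ { {()} }
  ; inverse   = (λ { {()} }) , λ {x} → contradiction x S-empty
  }

-- The canonical map from the integers to a commutative ring.

-- The ring solver with integer coefficients. The optimised multiples make 0 and 1
-- evaluate to 0# and 1# on the nose, so that con (+ 0) and con (+ 1) can stand for them.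
module IntegerCoefficients {c ℓ} (R : CommutativeRing c ℓ) where
  open CommutativeRing R
  open import Algebra.Properties.Semiring.Mult.TCOptimised semiring
    using (×-homo-+; ×1-homo-*; 1+×) renaming (_×_ to _×ₙ_)
  open import Algebra.Properties.Ring ring using (-‿distribˡ-*; -‿distribʳ-*; -0#≈0#; -‿involutive)
  open import Algebra.Properties.AbelianGroup +-abelianGroup using (⁻¹-∙-comm; xyx⁻¹≈y)
  open import Relation.Binary.Reasoning.Setoid setoid

  ⟦_⟧ : ℤ → Carrier
  ⟦ + n ⟧      = n ×ₙ 1#
  ⟦ -[1+ n ] ⟧ = - (suc n ×ₙ 1#)

  x+y-[x+z] : ∀ x y z → (x + y) - (x + z) ≈ y - z
  x+y-[x+z] x y z = begin
    (x + y) - (x + z)      ≈⟨ +-congˡ (⁻¹-∙-comm x z) ⟨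
    (x + y) + (- x + - z)  ≈⟨ +-assoc _ _ _ ⟨
    ((x + y) - x) - z      ≈⟨ +-congʳ (xyx⁻¹≈y x y) ⟩
    y - z                  ∎

  -- Integers of opposite signs are added by `⊖`, so the mixed cases of `⟦⟧-+` rest on this. The
  -- recursion of `⊖` removes 1 from both arguments, and `x+y-[x+z]` cancels the matching `1#` in
  -- the ring.
  ⟦⟧-⊖ : ∀ m n → ⟦ m ℤ.⊖ n ⟧ ≈ m ×ₙ 1# - n ×ₙ 1#
  ⟦⟧-⊖ m       zero    = sym (trans (+-congˡ -0#≈0#) (+-identityʳ _))
  ⟦⟧-⊖ zero    (suc n) = sym (+-identityˡ _)
  ⟦⟧-⊖ (suc m) (suc n) = begin
    ⟦ suc m ℤ.⊖ suc n ⟧              ≡⟨ ≡.cong ⟦_⟧ (ℤ.[1+m]⊖[1+n]≡m⊖n m n) ⟩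
    ⟦ m ℤ.⊖ n ⟧                      ≈⟨ ⟦⟧-⊖ m n ⟩
    m ×ₙ 1# - n ×ₙ 1#                ≈⟨ x+y-[x+z] 1# _ _ ⟨
    (1# + m ×ₙ 1#) - (1# + n ×ₙ 1#)  ≈⟨ +-cong (1+× m 1#) (-‿cong (1+× n 1#)) ⟨
    suc m ×ₙ 1# - suc n ×ₙ 1#        ∎

  ⟦⟧-neg : ∀ i → ⟦ ℤ.- i ⟧ ≈ - ⟦ i ⟧
  ⟦⟧-neg (+ zero)   = sym -0#≈0#
  ⟦⟧-neg (+ suc n)  = refl
  ⟦⟧-neg (-[1+ n ]) = sym (-‿involutive _)

  ⟦⟧-+ : ∀ i j → ⟦ i ℤ.+ j ⟧ ≈ ⟦ i ⟧ + ⟦ j ⟧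
  ⟦⟧-+ (+ m)      (+ n)      = ×-homo-+ 1# m n
  ⟦⟧-+ (+ m)      (-[1+ n ]) = ⟦⟧-⊖ m (suc n)
  ⟦⟧-+ (-[1+ m ]) (+ n)      = trans (⟦⟧-⊖ n (suc m)) (+-comm _ _)
  ⟦⟧-+ (-[1+ m ]) (-[1+ n ]) = begin
    - (suc (suc (m ℕ.+ n)) ×ₙ 1#)  ≡⟨ ≡.cong (λ k → - (suc k ×ₙ 1#)) (ℕ.+-suc m n) ⟨
    - ((suc m ℕ.+ suc n) ×ₙ 1#)    ≈⟨ -‿cong (×-homo-+ 1# (suc m) (suc n)) ⟩
    - (suc m ×ₙ 1# + suc n ×ₙ 1#)  ≈⟨ ⁻¹-∙-comm _ _ ⟨
    - (suc m ×ₙ 1#) - suc n ×ₙ 1#  ∎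

  ⟦⟧-*-+ : ∀ m j → ⟦ + m ℤ.* j ⟧ ≈ m ×ₙ 1# * ⟦ j ⟧
  ⟦⟧-*-+ m (+ n) = begin
    ⟦ + m ℤ.* + n ⟧    ≡⟨ ≡.cong ⟦_⟧ (ℤ.pos-* m n) ⟨
    (m ℕ.* n) ×ₙ 1#    ≈⟨ ×1-homo-* m n ⟩
    m ×ₙ 1# * n ×ₙ 1#  ∎
  ⟦⟧-*-+ m (-[1+ n ]) = begin
    ⟦ + m ℤ.* -[1+ n ] ⟧       ≡⟨ ≡.cong ⟦_⟧ (ℤ.neg-distribʳ-* (+ m) (+ suc n)) ⟨
    ⟦ ℤ.- (+ m ℤ.* + suc n) ⟧  ≈⟨ ⟦⟧-neg (+ m ℤ.* + suc n) ⟩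
    - ⟦ + m ℤ.* + suc n ⟧      ≈⟨ -‿cong (⟦⟧-*-+ m (+ suc n)) ⟩
    - (m ×ₙ 1# * suc n ×ₙ 1#)  ≈⟨ -‿distribʳ-* _ _ ⟩
    m ×ₙ 1# * - (suc n ×ₙ 1#)  ∎

  ⟦⟧-* : ∀ i j → ⟦ i ℤ.* j ⟧ ≈ ⟦ i ⟧ * ⟦ j ⟧
  ⟦⟧-* (+ m)      j = ⟦⟧-*-+ m j
  ⟦⟧-* (-[1+ m ]) j = begin
    ⟦ -[1+ m ] ℤ.* j ⟧       ≡⟨ ≡.cong ⟦_⟧ (ℤ.neg-distribˡ-* (+ suc m) j) ⟨
    ⟦ ℤ.- (+ suc m ℤ.* j) ⟧  ≈⟨ ⟦⟧-neg (+ suc m ℤ.* j) ⟩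
    - ⟦ + suc m ℤ.* j ⟧      ≈⟨ -‿cong (⟦⟧-*-+ (suc m) j) ⟩
    - (suc m ×ₙ 1# * ⟦ j ⟧)  ≈⟨ -‿distribˡ-* _ _ ⟩
    - (suc m ×ₙ 1#) * ⟦ j ⟧  ∎

  morphism : ℤ.+-*-rawRing -Raw-AlmostCommutative⟶ fromCommutativeRing R
  morphism = record
    { ⟦_⟧    = ⟦_⟧
    ; +-homo = ⟦⟧-+
    ; *-homo = ⟦⟧-*
    ; -‿homo = ⟦⟧-neg
    ; 0-homo = refl
    ; 1-homo = refl
    }

  open Algebra.Solver.Ring ℤ.+-*-rawRing (fromCommutativeRing R) morphism
    (λ i j → Maybe.map (λ i≡j → reflexive (≡.cong ⟦_⟧ i≡j)) (dec⇒maybe (i ℤ.≟ j))) public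
    renaming (⟦_⟧ to ⟦_⟧ₚ)

-- Quadratic forms and symmetric matrices under linear substitution: formulas.

-- Over raw rings, so that the formulas can be read both in a field and in the
-- syntax of the ring solver. Those also found in Coordinates, SymmetricMatrices
-- and Hyperplanes agree with them definitionally.
module Substitutions {c ℓ} (R : RawRing c ℓ) where
  open Functional using (_∷_; [])
  open RawRing R
  open RawMonoidDefs +-rawMonoid using (sum) renaming (_×_ to _×ₙ_)

  infixl 7 _⊙_ _*ᴹ_ _·ᴹ_

  _⊙_ : Vector Carrier 3 → Vector Carrier 3 → Vector Carrier 6
  l ⊙ m =
      l 0F * m 0F
    ∷ l 0F * m 1F + l 1F * m 0F
    ∷ l 0F * m 2F + l 2F * m 0F
    ∷ l 1F * m 1F
    ∷ l 1F * m 2F + l 2F * m 1F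
    ∷ l 2F * m 2F
    ∷ []

  _*ᴹ_ : Vector (Vector Carrier 3) 3 → Vector (Vector Carrier 3) 3 → Vector (Vector Carrier 3) 3
  (A *ᴹ B) i j = sum (λ k → A i k * B k j)

  toMatrix : Vector Carrier 6 → Vector (Vector Carrier 3) 3
  toMatrix y =
      (y 0F ∷ y 1F ∷ y 2F ∷ [])
    ∷ (y 1F ∷ y 3F ∷ y 4F ∷ [])
    ∷ (y 2F ∷ y 4F ∷ y 5F ∷ [])
    ∷ []

  Δ : Vector Carrier 6 → Carrier
  Δ a = 4 ×ₙ (a 0F * a 3F * a 5F) + a 1F * a 2F * a 4F
        + - (a 0F * (a 4F * a 4F)) + - (a 3F * (a 2F * a 2F)) + - (a 5F * (a 1F * a 1F))

  net : Carrier → Carrier → Carrier → Carrier → Vector Carrier 6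
  net b c d e = 0# ∷ b ∷ c ∷ - c ∷ d ∷ e ∷ []

  _·ᴹ_ : Vector Carrier 3 → Vector (Vector Carrier 3) 3 → Vector Carrier 3
  (l ·ᴹ A) j = sum (λ i → l i * A i j)

  -- pullback A substitutes Σⱼ Aᵢⱼ Xⱼ for Xᵢ, hence rowProducts A for the monomials.
  rowProducts : Vector (Vector Carrier 3) 3 → Vector (Vector Carrier 6) 6
  rowProducts A =
      A 0F ⊙ A 0F ∷ A 0F ⊙ A 1F ∷ A 0F ⊙ A 2F
    ∷ A 1F ⊙ A 1F ∷ A 1F ⊙ A 2F ∷ A 2F ⊙ A 2F ∷ []

  pullback : Vector (Vector Carrier 3) 3 → Vector Carrier 6 → Vector Carrier 6
  pullback A a j = sum (λ i → a i * rowProducts A i j)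

  -- The transpose of `pullback A`. On the coordinates of a symmetric matrix M it is M ↦ A M Aᵀ, by
  -- `toMatrix-pushforward`.
  pushforward : Vector (Vector Carrier 3) 3 → Vector Carrier 6 → Vector Carrier 6
  pushforward A y i = sum (λ j → rowProducts A i j * y j)

  det : Vector (Vector Carrier 3) 3 → Carrier
  det A = A 0F 0F * (A 1F 1F * A 2F 2F + - (A 1F 2F * A 2F 1F))
        + - (A 0F 1F * (A 1F 0F * A 2F 2F + - (A 1F 2F * A 2F 0F)))
        + A 0F 2F * (A 1F 0F * A 2F 1F + - (A 1F 1F * A 2F 0F))

-- Polynomial identities for substitutions and for Δ.

module PullbackProperties {c ℓ} (F : Field c ℓ) where
  open Functional using (_∷_; [])
  open Field F
  open Coordinates F
  open SymmetricMatrices F using (Matrix; _*ᴹ_; 1ᴹ; _≈ᴹ_; toMatrix)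
  open Substitutions rawRing public using (Δ; net; _·ᴹ_; rowProducts; pullback; pushforward; det)
  open IntegerCoefficients commutativeRing
  open import Algebra.Properties.Semiring.Sum semiring using (sum-cong-≋)

  polynomialRing : ℕ → RawRing _ _
  polynomialRing n = record
    { Carrier = Polynomial n
    ; _≈_     = _≡_
    ; _+_     = _:+_
    ; _*_     = _:*_
    ; -_      = :-_
    ; 0#      = con (+ 0)
    ; 1#      = con (+ 1)
    }

  module Syntax {n : ℕ} = Substitutions (polynomialRing n)

  -- All components are compared at once as normal forms over the integers, before any field
  -- elements are inserted, so that `≡.refl` can settle the hypothesis. The conclusion is about
  -- tabulated vectors because `⟦ p i ⟧ₚ` in general unfolds to the intended field expression only
  -- at a concrete `i`.
  prove-≋ : ∀ {n k} (v : Vector Carrier n) (p q : Vector (Polynomial n) k) →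
            Vec.tabulate (normalise ∘ p) ≡ Vec.tabulate (normalise ∘ q) →
            Pointwise _≈_ (Vec.tabulate (λ i → ⟦ p i ⟧ₚ (Vec.tabulate v)))
                          (Vec.tabulate (λ i → ⟦ q i ⟧ₚ (Vec.tabulate v)))
  prove-≋ v p q p≡q = tabulate⁺ λ i →
    prove ρ (p i) (q i) (reflexive (≡.cong (λ r → ⟦ r ⟧N ρ) (tabulate⁻ (≡⇒Pointwise-≡ p≡q) i)))
    where
    ρ = Vec.tabulate v

  -- A block of variables that is preceded by k and followed by m others.
  vectorVar : ∀ k {n} m → Vector (Polynomial (k ℕ.+ (n ℕ.+ m))) n
  vectorVar k m i = var (k ↑ʳ (i ↑ˡ m))

  matrixVar : ∀ k m → Vector (Vector (Polynomial (k ℕ.+ (9 ℕ.+ m))) 3) 3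
  matrixVar k m i j = var (k ↑ʳ (combine i j ↑ˡ m))

  ⊙-cong : ∀ {l l′ m m′ : LinearForm} → l ≋ l′ → m ≋ m′ → l ⊙ m ≋ l′ ⊙ m′
  ⊙-cong p q 0F = *-cong (p 0F) (q 0F)
  ⊙-cong p q 1F = +-cong (*-cong (p 0F) (q 1F)) (*-cong (p 1F) (q 0F))
  ⊙-cong p q 2F = +-cong (*-cong (p 0F) (q 2F)) (*-cong (p 2F) (q 0F))
  ⊙-cong p q 3F = *-cong (p 1F) (q 1F)
  ⊙-cong p q 4F = +-cong (*-cong (p 1F) (q 2F)) (*-cong (p 2F) (q 1F))
  ⊙-cong p q 5F = *-cong (p 2F) (q 2F)

  rowProducts-cong : ∀ {A B} → A ≈ᴹ B → ∀ i → rowProducts A i ≋ rowProducts B i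
  rowProducts-cong p 0F = ⊙-cong (p 0F) (p 0F)
  rowProducts-cong p 1F = ⊙-cong (p 0F) (p 1F)
  rowProducts-cong p 2F = ⊙-cong (p 0F) (p 2F)
  rowProducts-cong p 3F = ⊙-cong (p 1F) (p 1F)
  rowProducts-cong p 4F = ⊙-cong (p 1F) (p 2F)
  rowProducts-cong p 5F = ⊙-cong (p 2F) (p 2F)

  pullback-cong : ∀ {A B} {a b : QuadraticForm} → A ≈ᴹ B → a ≋ b → pullback A a ≋ pullback B b
  pullback-cong p q j = sum-cong-≋ (λ i → *-cong (q i) (rowProducts-cong p i j))

  ·ᴹ-cong : ∀ {l m : LinearForm} {A B} → l ≋ m → A ≈ᴹ B → l ·ᴹ A ≋ m ·ᴹ B
  ·ᴹ-cong p q j = sum-cong-≋ (λ i → *-cong (p i) (q i j))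

  Δ-cong : ∀ {a b : QuadraticForm} → a ≋ b → Δ a ≈ Δ b
  Δ-cong p = +-cong (+-cong (+-cong (+-cong (4× (*-cong (*-cong (p 0F) (p 3F)) (p 5F)))
    (*-cong (*-cong (p 1F) (p 2F)) (p 4F)))
    (-‿cong (*-cong (p 0F) (*-cong (p 4F) (p 4F)))))
    (-‿cong (*-cong (p 3F) (*-cong (p 2F) (p 2F)))))
    (-‿cong (*-cong (p 5F) (*-cong (p 1F) (p 1F))))
    where
    4× : ∀ {x y} → x ≈ y → 4 ×ₙ x ≈ 4 ×ₙ y
    4× e = +-cong e (+-cong e (+-cong e (+-cong e refl)))

  -- Substitution respects products of polynomials and turns the linear form `l` into `l ·ᴹ A`.
  pullback-⊙ : ∀ A l m → pullback A (l ⊙ m) ≋ (l ·ᴹ A) ⊙ (m ·ᴹ A)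
  pullback-⊙ A l m = tabulate⁻ (prove-≋ (l ++ m ++ concat A) lhs rhs ≡.refl)
    where
    lᵥ = vectorVar 0 12
    mᵥ = vectorVar 3 9
    Aᵥ = matrixVar 6 0
    lhs rhs : Vector (Polynomial 15) 6
    lhs = Syntax.pullback Aᵥ (lᵥ Syntax.⊙ mᵥ)
    rhs = (lᵥ Syntax.·ᴹ Aᵥ) Syntax.⊙ (mᵥ Syntax.·ᴹ Aᵥ)

  pullback-· : ∀ A k a → pullback A (k · a) ≋ k · pullback A a
  pullback-· A k a = tabulate⁻ (prove-≋ (k ∷ a ++ concat A) lhs rhs ≡.refl)
    where
    kᵥ = var 0F
    aᵥ = vectorVar 1 9
    Aᵥ = matrixVar 7 0
    lhs rhs : Vector (Polynomial 16) 6
    lhs = Syntax.pullback Aᵥ (λ i → kᵥ :* aᵥ i)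
    rhs = λ j → kᵥ :* Syntax.pullback Aᵥ aᵥ j

  -- Replacing X by AX and then X by BX amounts to replacing X by A(BX), whence the order of the
  -- factors.
  pullback-* : ∀ A B a → pullback B (pullback A a) ≋ pullback (A *ᴹ B) a
  pullback-* A B a = tabulate⁻ (prove-≋ (a ++ concat A ++ concat B) lhs rhs ≡.refl)
    where
    aᵥ = vectorVar 0 18
    Aᵥ = matrixVar 6 9
    Bᵥ = matrixVar 15 0
    lhs rhs : Vector (Polynomial 24) 6
    lhs = Syntax.pullback Bᵥ (Syntax.pullback Aᵥ aᵥ)
    rhs = Syntax.pullback (Aᵥ Syntax.*ᴹ Bᵥ) aᵥ

  1ᴾ : ∀ {n} → Vector (Vector (Polynomial n) 3) 3
  1ᴾ = (con (+ 1) ∷ con (+ 0) ∷ con (+ 0) ∷ [])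
     ∷ (con (+ 0) ∷ con (+ 1) ∷ con (+ 0) ∷ [])
     ∷ (con (+ 0) ∷ con (+ 0) ∷ con (+ 1) ∷ [])
     ∷ []

  pullback-1ᴹ : ∀ a → pullback 1ᴹ a ≋ a
  pullback-1ᴹ a = tabulate⁻ (prove-≋ a lhs aᵥ ≡.refl)
    where
    aᵥ lhs : Vector (Polynomial 6) 6
    aᵥ = vectorVar 0 0
    lhs = Syntax.pullback 1ᴾ aᵥ

  ·ᴹ-* : ∀ l A B → (l ·ᴹ A) ·ᴹ B ≋ l ·ᴹ (A *ᴹ B)
  ·ᴹ-* l A B = tabulate⁻ (prove-≋ (l ++ concat A ++ concat B) lhs rhs ≡.refl)
    where
    lᵥ = vectorVar 0 18
    Aᵥ = matrixVar 3 9
    Bᵥ = matrixVar 12 0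
    lhs rhs : Vector (Polynomial 21) 3
    lhs = (lᵥ Syntax.·ᴹ Aᵥ) Syntax.·ᴹ Bᵥ
    rhs = lᵥ Syntax.·ᴹ (Aᵥ Syntax.*ᴹ Bᵥ)

  ·ᴹ-1ᴹ : ∀ l → l ·ᴹ 1ᴹ ≋ l
  ·ᴹ-1ᴹ l = tabulate⁻ (prove-≋ l lhs lᵥ ≡.refl)
    where
    lᵥ lhs : Vector (Polynomial 3) 3
    lᵥ = vectorVar 0 0
    lhs = lᵥ Syntax.·ᴹ 1ᴾ

  ·-·ᴹ : ∀ k (l : LinearForm) A → (k · l) ·ᴹ A ≋ k · (l ·ᴹ A)
  ·-·ᴹ k l A = tabulate⁻ (prove-≋ (k ∷ l ++ concat A) lhs rhs ≡.refl)
    where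
    kᵥ = var 0F
    lᵥ = vectorVar 1 9
    Aᵥ = matrixVar 4 0
    lhs rhs : Vector (Polynomial 13) 3
    lhs = (λ i → kᵥ :* lᵥ i) Syntax.·ᴹ Aᵥ
    rhs = λ j → kᵥ :* (lᵥ Syntax.·ᴹ Aᵥ) j

  -- Both sides are the double sum of `a i * rowProducts A i j * y j`. Thus a hyperplane contains
  -- the image of a point exactly when its pullback contains the point itself.
  pullback-adjoint : ∀ A a y → sum (λ j → pullback A a j * y j) ≈ sum (λ i → a i * pushforward A y i)
  pullback-adjoint A a y = prove (Vec.tabulate (a ++ y ++ concat A))
    (Σ₆ λ j → Syntax.pullback Aᵥ aᵥ j :* yᵥ j) (Σ₆ λ i → aᵥ i :* Syntax.pushforward Aᵥ yᵥ i) refl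
    where
    aᵥ = vectorVar 0 15
    yᵥ = vectorVar 6 9
    Aᵥ = matrixVar 12 0
    Σ₆ : Vector (Polynomial 21) 6 → Polynomial 21
    Σ₆ = RawMonoidDefs.sum (RawRing.+-rawMonoid (polynomialRing 21))

  toMatrix-pushforward : ∀ A y → toMatrix (pushforward A y) ≈ᴹ A *ᴹ toMatrix y *ᴹ transpose A
  toMatrix-pushforward A y = λ where
      0F → tabulate⁻ (prove-≋ v (lhs 0F) (rhs 0F) ≡.refl)
      1F → tabulate⁻ (prove-≋ v (lhs 1F) (rhs 1F) ≡.refl)
      2F → tabulate⁻ (prove-≋ v (lhs 2F) (rhs 2F) ≡.refl)
    where
    v = y ++ concat A
    yᵥ = vectorVar 0 9
    Aᵥ = matrixVar 6 0
    lhs rhs : Vector (Vector (Polynomial 15) 3) 3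
    lhs = Syntax.toMatrix (Syntax.pushforward Aᵥ yᵥ)
    rhs = Aᵥ Syntax.*ᴹ Syntax.toMatrix yᵥ Syntax.*ᴹ (λ i j → Aᵥ j i)

  -- 2Δ is the determinant of the Hessian matrix of the form, which a substitution turns from H into
  -- AᵀHA. After division by 2 the identity still has integer coefficients, so it holds in
  -- characteristic 2 as well.
  Δ-pullback : ∀ A a → Δ (pullback A a) ≈ det A * det A * Δ a
  Δ-pullback A a = prove (Vec.tabulate (a ++ concat A))
    (Syntax.Δ (Syntax.pullback Aᵥ aᵥ)) (Syntax.det Aᵥ :* Syntax.det Aᵥ :* Syntax.Δ aᵥ) refl
    where
    aᵥ = vectorVar 0 9
    Aᵥ = matrixVar 6 0

  Δ-· : ∀ k a → Δ (k · a) ≈ k * k * k * Δ a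
  Δ-· k a = prove (Vec.tabulate (k ∷ a))
    (Syntax.Δ (λ i → var 0F :* aᵥ i)) (var 0F :* var 0F :* var 0F :* Syntax.Δ aᵥ) refl
    where
    aᵥ = vectorVar 1 0

  -- The Hessian matrix of a product of linear forms is l mᵀ + m lᵀ, of rank at most 2.
  Δ-⊙ : ∀ l m → Δ (l ⊙ m) ≈ 0#
  Δ-⊙ l m = prove (Vec.tabulate (l ++ m))
    (Syntax.Δ (vectorVar 0 3 Syntax.⊙ vectorVar 3 0)) (con (+ 0)) refl

  Δ-net₁ : ∀ c d e → Δ (net 1# c d e) ≈ c * d + c * c * c - e
  Δ-net₁ = solve 3 (λ c d e →
    Syntax.Δ (Syntax.net (con (+ 1)) c d e) := c :* d :+ c :* c :* c :- e) refl

  Δ-net₂ : ∀ d e → Δ (net 0# 1# d e) ≈ 1#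
  Δ-net₂ = solve 2 (λ d e → Syntax.Δ (Syntax.net (con (+ 0)) (con (+ 1)) d e) := con (+ 1)) refl

  Δ-net₃ : ∀ d e → Δ (net 0# 0# d e) ≈ 0#
  Δ-net₃ = solve 2 (λ d e → Syntax.Δ (Syntax.net (con (+ 0)) (con (+ 0)) d e) := con (+ 0)) refl

-- Vanishing products in a field, and factorisations of a multiple of X₂².

module FieldProperties (F : Field c ℓ) where
  open Field F
  open Coordinates F
  open import Relation.Binary.Reasoning.Setoid setoid

  x*y≈0⇒y≈0 : ∀ {x y} → ¬ x ≈ 0# → x * y ≈ 0# → y ≈ 0#
  x*y≈0⇒y≈0 {x} {y} x≉0 xy≈0 with inverse x x≉0
  ... | x⁻¹ , xx⁻¹≈1 = begin
    y              ≈⟨ *-identityˡ y ⟨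
    1# * y         ≈⟨ *-congʳ (trans (*-comm x⁻¹ x) xx⁻¹≈1) ⟨
    x⁻¹ * x * y    ≈⟨ *-assoc x⁻¹ x y ⟩
    x⁻¹ * (x * y)  ≈⟨ *-congˡ xy≈0 ⟩
    x⁻¹ * 0#       ≈⟨ zeroʳ x⁻¹ ⟩
    0#             ∎

  x*y≈0⇒x≈0 : ∀ {x y} → ¬ y ≈ 0# → x * y ≈ 0# → x ≈ 0#
  x*y≈0⇒x≈0 y≉0 xy≈0 = x*y≈0⇒y≈0 y≉0 (trans (*-comm _ _) xy≈0)

  ≋⇒∝ : ∀ {n} {u v : Vector Carrier n} → u ≋ v → u ∝ v
  ≋⇒∝ u≋v = 1# , 1≉0 , λ i → trans (u≋v i) (sym (*-identityˡ _))

  x≈0⇒x*y+z≈z : ∀ {x y z} → x ≈ 0# → x * y + z ≈ z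
  x≈0⇒x*y+z≈z {x} {y} {z} x≈0 = trans (+-congʳ (trans (*-congʳ x≈0) (zeroˡ y))) (+-identityˡ z)

  x≈0⇒z+y*x≈z : ∀ {x y z} → x ≈ 0# → z + y * x ≈ z
  x≈0⇒z+y*x≈z {x} {y} {z} x≈0 = trans (+-congˡ (trans (*-congˡ x≈0) (zeroʳ y))) (+-identityʳ z)

  ∝-IsZero : ∀ {n} {u v : Vector Carrier n} i → u ∝ v → u i ≈ 0# → v i ≈ 0#
  ∝-IsZero i (k , k≉0 , u≋kv) uᵢ≈0 = x*y≈0⇒y≈0 k≉0 (trans (sym (u≋kv i)) uᵢ≈0)

  module _ (_≟_ : Decidable _≈_) where

    x*y≈0⇒x≈0∨y≈0 : ∀ {x y} → x * y ≈ 0# → x ≈ 0# ⊎ y ≈ 0#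
    x*y≈0⇒x≈0∨y≈0 {x} xy≈0 with x ≟ 0#
    ... | yes x≈0 = inj₁ x≈0
    ... | no  x≉0 = inj₂ (x*y≈0⇒y≈0 x≉0 xy≈0)

    x*x≈0⇒x≈0 : ∀ {x} → x * x ≈ 0# → x ≈ 0#
    x*x≈0⇒x≈0 xx≈0 = [ id , id ]′ (x*y≈0⇒x≈0∨y≈0 xx≈0)

    -- If x y ≠ 0 and (r X + x Y)(s X + y Y) = x y Y², then r = s = 0.
    factors-of-square : ∀ {r s x y} → ¬ x ≈ 0# → ¬ y ≈ 0# →
                        r * s ≈ 0# → r * y + x * s ≈ 0# → r ≈ 0# × s ≈ 0#
    factors-of-square x≉0 y≉0 rs≈0 ry+xs≈0 with x*y≈0⇒x≈0∨y≈0 rs≈0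
    ... | inj₁ r≈0 = r≈0 , x*y≈0⇒y≈0 x≉0 (trans (sym (x≈0⇒x*y+z≈z r≈0)) ry+xs≈0)
    ... | inj₂ s≈0 = x*y≈0⇒x≈0 y≉0 (trans (sym (x≈0⇒z+y*x≈z s≈0)) ry+xs≈0) , s≈0

    -- Since l₂ m₂ ≠ 0, `factors-of-square` applies to the variables X₀, X₂ and again to X₁, X₂. It
    -- leaves both factors as nonzero multiples of X₂.
    l⊙m∝X₂²⇒l∝m : ∀ {l m} → (∀ i → ¬ i ≡ 5F → (l ⊙ m) i ≈ 0#) → ¬ (l ⊙ m) 5F ≈ 0# → l ∝ m
    l⊙m∝X₂²⇒l∝m {l} {m} lm≈0 l₂m₂≉0 = l 2F * m₂⁻¹ , k≉0 , λ where
        0F → zeros (proj₁ X₀) (proj₂ X₀)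
        1F → zeros (proj₁ X₁) (proj₂ X₁)
        2F → begin
          l 2F                  ≈⟨ *-identityʳ _ ⟨
          l 2F * 1#             ≈⟨ *-congˡ m₂m₂⁻¹≈1 ⟨
          l 2F * (m 2F * m₂⁻¹)  ≈⟨ *-congˡ (*-comm _ _) ⟩
          l 2F * (m₂⁻¹ * m 2F)  ≈⟨ *-assoc _ _ _ ⟨
          l 2F * m₂⁻¹ * m 2F    ∎
      where
      l₂≉0 : ¬ l 2F ≈ 0#
      l₂≉0 l₂≈0 = l₂m₂≉0 (trans (*-congʳ l₂≈0) (zeroˡ _))
      m₂≉0 : ¬ m 2F ≈ 0#
      m₂≉0 m₂≈0 = l₂m₂≉0 (trans (*-congˡ m₂≈0) (zeroʳ _))
      m₂⁻¹ = proj₁ (inverse _ m₂≉0)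
      m₂m₂⁻¹≈1 = proj₂ (inverse _ m₂≉0)
      X₀ = factors-of-square l₂≉0 m₂≉0 (lm≈0 0F λ ()) (lm≈0 2F λ ())
      X₁ = factors-of-square l₂≉0 m₂≉0 (lm≈0 3F λ ()) (lm≈0 4F λ ())
      zeros : ∀ {x y k} → x ≈ 0# → y ≈ 0# → x ≈ k * y
      zeros x≈0 y≈0 = trans x≈0 (sym (trans (*-congˡ y≈0) (zeroʳ _)))
      k≉0 : ¬ l 2F * m₂⁻¹ ≈ 0#
      k≉0 k≈0 = 1≉0 (trans (sym m₂m₂⁻¹≈1) (trans (*-congˡ (x*y≈0⇒y≈0 l₂≉0 k≈0)) (zeroʳ _)))

-- Base change of forms and substitutions along a ring homomorphism.

module HomomorphismProperties (F : Field c ℓ) (E : Field c′ ℓ′)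
  {f : Field.Carrier F → Field.Carrier E}
  (f-hom : IsRingHomomorphism (Field.rawRing F) (Field.rawRing E) f) where
  private
    module F where
      open Field F public
      open Coordinates F public
      open SymmetricMatrices F public using (Matrix; _*ᴹ_; 1ᴹ)
      open PullbackProperties F public using (_·ᴹ_; pullback; rowProducts)
    module E where
      open Field E public
      open Coordinates E public
      open SymmetricMatrices E public using (Matrix; _*ᴹ_; 1ᴹ; _≈ᴹ_)
      open PullbackProperties E public using (_·ᴹ_; pullback; rowProducts)
      open import Algebra.Properties.Semiring.Sum semiring public using (sum-cong-≋)
  open IsRingHomomorphism f-hom

  mapᴹ : F.Matrix → E.Matrix
  mapᴹ A i j = f (A i j)

  sum-homo : ∀ {n} (v : Vector F.Carrier n) → f (F.sum v) E.≈ E.sum (map f v)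
  sum-homo {zero}   v = 0#-homo
  sum-homo {suc n} v = E.trans (+-homo _ _) (E.+-congˡ (sum-homo (v ∘ Fin.suc)))

  dot-homo : ∀ {n} (u v : Vector F.Carrier n) →
             f (F.sum (λ i → u i F.* v i)) E.≈ E.sum (λ i → f (u i) E.* f (v i))
  dot-homo u v = E.trans (sum-homo (λ i → u i F.* v i)) (E.sum-cong-≋ λ i → *-homo (u i) (v i))

  ⊙-homo : ∀ l m → map f (l F.⊙ m) E.≋ map f l E.⊙ map f m
  ⊙-homo l m = λ where
      0F → *-homo _ _
      1F → polar _ _ _ _
      2F → polar _ _ _ _
      3F → *-homo _ _
      4F → polar _ _ _ _
      5F → *-homo _ _
    where
    polar : ∀ w x y z → f (w F.* x F.+ y F.* z) E.≈ f w E.* f x E.+ f y E.* f z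
    polar w x y z = E.trans (+-homo _ _) (E.+-cong (*-homo _ _) (*-homo _ _))

  rowProducts-homo : ∀ A i → map f (F.rowProducts A i) E.≋ E.rowProducts (mapᴹ A) i
  rowProducts-homo A = λ where
    0F → ⊙-homo (A 0F) (A 0F)
    1F → ⊙-homo (A 0F) (A 1F)
    2F → ⊙-homo (A 0F) (A 2F)
    3F → ⊙-homo (A 1F) (A 1F)
    4F → ⊙-homo (A 1F) (A 2F)
    5F → ⊙-homo (A 2F) (A 2F)

  pullback-homo : ∀ A a → map f (F.pullback A a) E.≋ E.pullback (mapᴹ A) (map f a)
  pullback-homo A a j = E.trans (dot-homo a (λ i → F.rowProducts A i j))
    (E.sum-cong-≋ λ i → E.*-congˡ {f (a i)} (rowProducts-homo A i j))

  ·ᴹ-homo : ∀ l A → map f (l F.·ᴹ A) E.≋ map f l E.·ᴹ mapᴹ A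
  ·ᴹ-homo l A j = dot-homo l (λ i → A i j)

  *ᴹ-homo : ∀ A B → mapᴹ (A F.*ᴹ B) E.≈ᴹ mapᴹ A E.*ᴹ mapᴹ B
  *ᴹ-homo A B i j = dot-homo (A i) (λ k → B k j)

  1ᴹ-homo : mapᴹ F.1ᴹ E.≈ᴹ E.1ᴹ
  1ᴹ-homo = λ where
    0F 0F → 1#-homo
    0F 1F → 0#-homo
    0F 2F → 0#-homo
    1F 0F → 0#-homo
    1F 1F → 1#-homo
    1F 2F → 0#-homo
    2F 0F → 0#-homo
    2F 1F → 0#-homo
    2F 2F → 1#-homo

  x≉0⇒fx≉0 : ∀ {x} → ¬ x F.≈ F.0# → ¬ f x E.≈ E.0#
  x≉0⇒fx≉0 {x} x≉0 fx≈0 with F.inverse x x≉0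
  ... | y , xy≈1 = E.1≉0 (begin
    E.1#         ≈⟨ 1#-homo ⟨
    f F.1#       ≈⟨ ⟦⟧-cong xy≈1 ⟨
    f (x F.* y)  ≈⟨ *-homo x y ⟩
    f x E.* f y  ≈⟨ E.*-congʳ fx≈0 ⟩
    E.0# E.* f y ≈⟨ E.zeroˡ _ ⟩
    E.0#         ∎)
    where open import Relation.Binary.Reasoning.Setoid E.setoid

-- Invertible substitutions act on nonzero forms up to proportionality.

module InvertibleSubstitutions (F : Field c ℓ) where
  open Field F
  open Coordinates F
  open SymmetricMatrices F using (Matrix; _*ᴹ_; 1ᴹ; _≈ᴹ_)
  open PullbackProperties F

  pullback-∝ : ∀ A {a b} → a ∝ b → pullback A a ∝ pullback A b
  pullback-∝ A {a} {b} (k , k≉0 , a≋kb) = k , k≉0 , λ j →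
    trans (pullback-cong {A} {A} (λ _ _ → refl) a≋kb j) (pullback-· A k b j)

  module _ (A B : Matrix) (AB≈1 : A *ᴹ B ≈ᴹ 1ᴹ) where

    pullback-inverse : ∀ a → pullback B (pullback A a) ≋ a
    pullback-inverse a j = trans (pullback-* A B a j)
      (trans (pullback-cong {A *ᴹ B} {1ᴹ} {a} AB≈1 (λ _ → refl) j) (pullback-1ᴹ a j))

    pullback-nonzero : ∀ {a} → ¬ IsZero a → ¬ IsZero (pullback A a)
    pullback-nonzero {a} a≉0 Aa≈0 = a≉0 λ j → begin
      a j                                 ≈⟨ pullback-inverse a j ⟨
      pullback B (pullback A a) j         ≈⟨ pullback-cong {B} {B} (λ _ _ → refl)
                                               (λ i → trans (Aa≈0 i) (sym (zeroˡ 0#))) j ⟩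
      -- The zero form is written as a multiple by `0#`, so that homogeneity of `pullback` shows
      -- that its pullback is zero.
      pullback B (0# · (λ _ → 0#)) j      ≈⟨ pullback-· B 0# (λ _ → 0#) j ⟩
      0# * pullback B (λ _ → 0#) j        ≈⟨ zeroˡ _ ⟩
      0#                                  ∎
      where open import Relation.Binary.Reasoning.Setoid setoid

    ·ᴹ-inverse : ∀ l → (l ·ᴹ A) ·ᴹ B ≋ l
    ·ᴹ-inverse l j = trans (·ᴹ-* l A B j)
      (trans (·ᴹ-cong {l} {l} {A *ᴹ B} {1ᴹ} (λ _ → refl) AB≈1 j) (·ᴹ-1ᴹ l j))

    ·ᴹ-cancel-∝ : ∀ {l m} → l ·ᴹ A ∝ m ·ᴹ A → l ∝ m
    ·ᴹ-cancel-∝ {l} {m} (k , k≉0 , lA≋kmA) = k , k≉0 , λ j → begin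
      l j                       ≈⟨ ·ᴹ-inverse l j ⟨
      ((l ·ᴹ A) ·ᴹ B) j         ≈⟨ ·ᴹ-cong {l ·ᴹ A} {k · (m ·ᴹ A)} {B} {B} lA≋kmA (λ _ _ → refl) j ⟩
      ((k · (m ·ᴹ A)) ·ᴹ B) j   ≈⟨ ·-·ᴹ k (m ·ᴹ A) B j ⟩
      k * ((m ·ᴹ A) ·ᴹ B) j     ≈⟨ *-congˡ (·ᴹ-inverse m j) ⟩
      k * m j                   ∎
      where open import Relation.Binary.Reasoning.Setoid setoid

-- Hyperplanes through the line and the net of conics.

module Containment (F : Field c ℓ) where
  open Functional using (_∷_; [])
  open Field F
  open Coordinates F
  open Projective F
  open SymmetricMatrices F using (GL₃; toMatrix; _≈ᴹ_; ℓ₉; image)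
  open PullbackProperties F
  open IntegerCoefficients commutativeRing using (solve; _:=_; _:*_; _:+_; con)
  open import Algebra.Properties.Semiring.Sum semiring using (sum-cong-≋; *-distribˡ-sum)
  open import Relation.Binary.Reasoning.Setoid setoid

  _∙_ : ∀ {n} → Vector Carrier n → Vector Carrier n → Carrier
  u ∙ v = sum (λ i → u i * v i)

  ∙-congˡ : ∀ {n} (u v w : Vector Carrier n) → v ≋ w → u ∙ v ≈ u ∙ w
  ∙-congˡ u v w v≋w = sum-cong-≋ (λ i → *-congˡ {u i} (v≋w i))

  ∙-· : ∀ {n} (u : Vector Carrier n) k v → u ∙ (k · v) ≈ k * (u ∙ v)
  ∙-· u k v = trans
    (sum-cong-≋ λ i → trans (sym (*-assoc (u i) k (v i)))
                     (trans (*-congʳ (*-comm (u i) k)) (*-assoc k (u i) (v i))))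
    (sym (*-distribˡ-sum k (λ i → u i * v i)))

  -- These are the coefficients of x and y in the pairing of the form with a general point of `ℓ₉`;
  -- see `∙-ℓ₉`.
  IsNet : Pred QuadraticForm ℓ
  IsNet a = a 0F ≈ 0# × a 2F + a 3F ≈ 0#

  ℓ₉-coord : Carrier → Carrier → Vector Carrier 6
  ℓ₉-coord x y = x ∷ 0# ∷ y ∷ y ∷ 0# ∷ 0# ∷ []

  ∙-ℓ₉ : ∀ a x y → a ∙ ℓ₉-coord x y ≈ a 0F * x + (a 2F + a 3F) * y
  ∙-ℓ₉ a x y = solve 8 (λ a₀ a₁ a₂ a₃ a₄ a₅ x y → let 0ₚ = con (+ 0) in
      a₀ :* x :+ (a₁ :* 0ₚ :+ (a₂ :* y :+ (a₃ :* y :+ (a₄ :* 0ₚ :+ (a₅ :* 0ₚ :+ 0ₚ)))))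
      := a₀ :* x :+ (a₂ :+ a₃) :* y)
    refl (a 0F) (a 1F) (a 2F) (a 3F) (a 4F) (a 5F) x y

  ℓ₉-coord⇒ℓ₉ : ∀ R x y → coord R ≋ ℓ₉-coord x y → ℓ₉ R
  ℓ₉-coord⇒ℓ₉ R x y R≋ = x , y , λ where
    0F 0F → R≋ 0F
    0F 1F → R≋ 1F
    0F 2F → R≋ 2F
    1F 0F → R≋ 1F
    1F 1F → R≋ 3F
    1F 2F → R≋ 4F
    2F 0F → R≋ 2F
    2F 1F → R≋ 4F
    2F 2F → R≋ 5F

  toMatrix-injective : ∀ y z → toMatrix y ≈ᴹ toMatrix z → y ≋ z
  toMatrix-injective y z p = λ where
    0F → p 0F 0F
    1F → p 0F 1F
    2F → p 0F 2F
    3F → p 1F 1F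
    4F → p 1F 2F
    5F → p 2F 2F

  toMatrix-· : ∀ k y i → k · toMatrix y i ≋ toMatrix (k · y) i
  toMatrix-· k y = λ where
    0F 0F → refl
    0F 1F → refl
    0F 2F → refl
    1F 0F → refl
    1F 1F → refl
    1F 2F → refl
    2F 0F → refl
    2F 1F → refl
    2F 2F → refl

  module Translate (_≟_ : Decidable _≈_) (A : GL₃) (L : Line 5)
    (L≐Aℓ₉ : points L ≐ image A ℓ₉) where
    open GL₃ A using (matrix)

    -- If the product were nonzero, the image of R would be a genuine point, hence on L.
    Contains⇒∙≈0 : ∀ H → Contains L H → ∀ R → ℓ₉ R → pullback matrix (coord H) ∙ coord R ≈ 0#
    Contains⇒∙≈0 H L⊆H R R∈ℓ₉ = decidable-stable (_ ≟ 0#) λ ≉0 → ≉0 (L⊆H⇒≈0 ≉0)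
      where
      y = pushforward matrix (coord R)
      adjoint : pullback matrix (coord H) ∙ coord R ≈ coord H ∙ y
      adjoint = pullback-adjoint matrix (coord H) (coord R)
      y≉0 : ¬ pullback matrix (coord H) ∙ coord R ≈ 0# → ¬ IsZero y
      y≉0 ≉0 y≈0 = ≉0 (begin
        pullback matrix (coord H) ∙ coord R  ≈⟨ adjoint ⟩
        coord H ∙ y                          ≈⟨ ∙-congˡ (coord H) y (0# · y) y≋0·y ⟩
        coord H ∙ (0# · y)                   ≈⟨ ∙-· (coord H) 0# y ⟩
        0# * (coord H ∙ y)                   ≈⟨ zeroˡ _ ⟩
        0#                                   ∎)
        where
        y≋0·y : y ≋ 0# · y
        y≋0·y i = trans (y≈0 i) (sym (zeroˡ (y i)))
      L⊆H⇒≈0 : ¬ pullback matrix (coord H) ∙ coord R ≈ 0# → pullback matrix (coord H) ∙ coord R ≈ 0#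
      L⊆H⇒≈0 ≉0 = trans adjoint (L⊆H AR (proj₂ L≐Aℓ₉ {AR} (R , R∈ℓ₉ , 1# , 1≉0 , λ i j →
        trans (toMatrix-pushforward matrix (coord R) i j) (sym (*-identityˡ _)))))
        where
        AR : Point 5
        AR = record { coord = y ; nonzero = y≉0 ≉0 }

    -- The two conditions are read off at the points (1, 0) and (0, 1) of `ℓ₉`.
    Contains⇒IsNet : ∀ H → Contains L H → IsNet (pullback matrix (coord H))
    Contains⇒IsNet H L⊆H = net₀ , net₁
      where
      f = pullback matrix (coord H)
      f∙ℓ₉≈0 : ∀ x y → ¬ IsZero (ℓ₉-coord x y) → f ∙ ℓ₉-coord x y ≈ 0#
      f∙ℓ₉≈0 x y ≉0 = Contains⇒∙≈0 H L⊆H R (ℓ₉-coord⇒ℓ₉ R x y λ _ → refl)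
        where R = record { coord = ℓ₉-coord x y ; nonzero = ≉0 }
      net₀ = begin
        f 0F                                ≈⟨ solve 2 (λ x y → x := x :* con (+ 1) :+ y :* con (+ 0))
                                                 refl (f 0F) (f 2F + f 3F) ⟩
        f 0F * 1# + (f 2F + f 3F) * 0#      ≈⟨ ∙-ℓ₉ f 1# 0# ⟨
        f ∙ ℓ₉-coord 1# 0#                  ≈⟨ f∙ℓ₉≈0 1# 0# (λ ≈0 → 1≉0 (≈0 0F)) ⟩
        0#                                  ∎
      net₁ = begin
        f 2F + f 3F                         ≈⟨ solve 2 (λ x y → y := x :* con (+ 0) :+ y :* con (+ 1))
                                                 refl (f 0F) (f 2F + f 3F) ⟩
        f 0F * 0# + (f 2F + f 3F) * 1#      ≈⟨ ∙-ℓ₉ f 0# 1# ⟨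
        f ∙ ℓ₉-coord 0# 1#                  ≈⟨ f∙ℓ₉≈0 0# 1# (λ ≈0 → 1≉0 (≈0 2F)) ⟩
        0#                                  ∎

    -- Each point of L is a multiple of the image of a point of `ℓ₉`. By adjointness the matrix
    -- moves over to the hyperplane, whose pullback vanishes on `ℓ₉`.
    IsNet⇒Contains : ∀ H → IsNet (pullback matrix (coord H)) → Contains L H
    IsNet⇒Contains H (f₀≈0 , f₂+f₃≈0) R R∈L with proj₁ L≐Aℓ₉ {R} R∈L
    ... | R′ , (x , y , R′≈) , k , _ , R≈kAR′ = begin
      coord H ∙ coord R                   ≈⟨ ∙-congˡ (coord H) (coord R) (k · y′) R≋ky′ ⟩
      coord H ∙ (k · y′)                  ≈⟨ ∙-· (coord H) k y′ ⟩
      k * (coord H ∙ y′)                  ≈⟨ *-congˡ (pullback-adjoint matrix (coord H) (coord R′)) ⟨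
      k * (f ∙ coord R′)                  ≈⟨ *-congˡ (∙-congˡ f (coord R′) (ℓ₉-coord x y) R′≋) ⟩
      k * (f ∙ ℓ₉-coord x y)              ≈⟨ *-congˡ (∙-ℓ₉ f x y) ⟩
      k * (f 0F * x + (f 2F + f 3F) * y)  ≈⟨ *-congˡ (+-cong (*-congʳ f₀≈0) (*-congʳ f₂+f₃≈0)) ⟩
      k * (0# * x + 0# * y)               ≈⟨ solve 3 (λ k x y →
                                               k :* (con (+ 0) :* x :+ con (+ 0) :* y) := con (+ 0))
                                               refl k x y ⟩
      0#                                  ∎
      where
      f = pullback matrix (coord H)
      y′ = pushforward matrix (coord R′)
      R≋ky′ : coord R ≋ k · y′
      R≋ky′ = toMatrix-injective (coord R) (k · y′) λ i j → trans (R≈kAR′ i j)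
        (trans (*-congˡ (sym (toMatrix-pushforward matrix (coord R′) i j))) (toMatrix-· k y′ i j))
      R′≋ : coord R′ ≋ ℓ₉-coord x y
      R′≋ = λ where
        0F → R′≈ 0F 0F
        1F → R′≈ 0F 1F
        2F → R′≈ 0F 2F
        3F → R′≈ 1F 1F
        4F → R′≈ 1F 2F
        5F → R′≈ 2F 2F

-- Counting hyperplanes through the line by normal forms in the net.

module Counting (F : Field c ℓ) where
  open Field F
  open Coordinates F
  open Projective F
  open SymmetricMatrices F using (GL₃; ℓ₉; image)
  open PullbackProperties F
  open InvertibleSubstitutions F
  open Containment F
  open FieldProperties F using (≋⇒∝)

  -- `T` parametrises exactly one representative of each proportionality class of nonzero forms in
  -- the net that satisfy `P`.
  record NormalForms (P : Pred QuadraticForm p) (T : Setoid a b) : Set (c ⊔ ℓ ⊔ p ⊔ a ⊔ b) where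
    open Setoid T using () renaming (Carrier to |T|; _≈_ to _≈ₜ_)
    field
      form       : |T| → QuadraticForm
      cong       : ∀ {t u} → t ≈ₜ u → form t ≋ form u
      injective  : ∀ {t u} → form t ∝ form u → t ≈ₜ u
      nonzero    : ∀ t → ¬ IsZero (form t)
      isNet      : ∀ t → IsNet (form t)
      inP        : ∀ t → P (form t)
      surjective : ∀ f → ¬ IsZero f → IsNet f → P f → ∃ λ t → f ∝ form t

  module TranslateCount (_≟_ : Decidable _≈_) (A : GL₃) (L : Line 5)
    (L≐Aℓ₉ : points L ≐ image A ℓ₉) where
    open Translate _≟_ A L L≐Aℓ₉
    open GL₃ A

    -- Pullback along A takes the hyperplanes through L to the net, and pullback along A⁻¹ takes
    -- them back. Invariance of `P` is applied to both matrices, so the normal forms count the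
    -- hyperplanes through L with property `P`.
    count : ∀ {P : Pred QuadraticForm p} {T : Setoid a b} {n} →
            (∀ (B : GL₃) {f} → P f → P (pullback (GL₃.matrix B) f)) →
            NormalForms P T → HasCardinality T n → CountHyperplanes ((P ∘ coord) ∩ Contains L) n
    count {P = P} {T} P-pullback normalForms T≅n =
      Composition.inverse (Symmetry.inverse (Bijection⇒Inverse bijection)) T≅n
      where
      open NormalForms normalForms using (form)
      module NF = NormalForms normalForms

      A⁻¹ : GL₃
      A⁻¹ = record { matrix = matrix⁻¹ ; matrix⁻¹ = matrix
                   ; inverseˡ = inverseʳ ; inverseʳ = inverseˡ }

      pull-push : ∀ f → pullback matrix (pullback matrix⁻¹ f) ≋ f
      pull-push = pullback-inverse matrix⁻¹ matrix inverseˡ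

      hyperplane : Setoid.Carrier T → ∃ ((P ∘ coord) ∩ Contains L)
      hyperplane t = H , P-pullback A⁻¹ (NF.inP t) , IsNet⇒Contains H
        ( trans (pull-push (form t) 0F) (proj₁ (NF.isNet t))
        , trans (+-cong (pull-push (form t) 2F) (pull-push (form t) 3F)) (proj₂ (NF.isNet t)))
        where
        H : Hyperplane 5
        H = record { coord   = pullback matrix⁻¹ (form t)
                   ; nonzero = pullback-nonzero matrix⁻¹ matrix inverseˡ (NF.nonzero t)
                   }

      bijection : Bijection T (On.setoid (PG 5) (proj₁ {B = (P ∘ coord) ∩ Contains L}))
      bijection = record
        { to        = hyperplane
        ; cong      = cong′
        ; bijective =
            (λ {t} {u} t∝u → NF.injective (∝-trans (∝-sym (≋⇒∝ (pull-push (form t))))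
              (∝-trans (pullback-∝ matrix t∝u) (≋⇒∝ (pull-push (form u))))))
          , λ (H , H∈P , L⊆H) →
              let t , AH∝t = NF.surjective (pullback matrix (coord H))
                    (pullback-nonzero matrix matrix⁻¹ inverseʳ (Point.nonzero H))
                    (Contains⇒IsNet H L⊆H) (P-pullback A H∈P)
              in t , λ z≈t → ∝-trans (cong′ z≈t) (∝-trans (∝-sym (pullback-∝ matrix⁻¹ AH∝t))
                    (≋⇒∝ (pullback-inverse matrix matrix⁻¹ inverseʳ (coord H))))
        }
        where
        cong′ : ∀ {t u} → Setoid._≈_ T t u → pullback matrix⁻¹ (form t) ∝ pullback matrix⁻¹ (form u)
        cong′ t≈u = pullback-∝ matrix⁻¹ (≋⇒∝ (NF.cong t≈u))

-- Invariance of the classes of conics under substitution.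

module FormClasses (F : Field c ℓ) where
  open Field F
  open Coordinates F
  open SymmetricMatrices F using (GL₃)
  open PullbackProperties F
  open InvertibleSubstitutions F

  -- This predicate and the next two are stated on forms so that pullbacks can be tested as well.
  -- Composed with `coord`, they unfold to `𝓗₁`, `𝓗₂ᵣ` and `𝓗₃`.
  DoubleLine : Pred QuadraticForm (c ⊔ ℓ)
  DoubleLine f = ∃₂ λ k l → f ≋ k · (l ⊙ l)

  RealLinePair : Pred QuadraticForm (c ⊔ ℓ)
  RealLinePair f = ∃₂ λ l m → ¬ l ∝ m × f ≋ l ⊙ m

  Nonsingular : Pred QuadraticForm ℓ
  Nonsingular f = ¬ Δ f ≈ 0#

  pullback-·-⊙ : ∀ A k l m {f} → f ≋ k · (l ⊙ m) → pullback A f ≋ k · ((l ·ᴹ A) ⊙ (m ·ᴹ A))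
  pullback-·-⊙ A k l m {f} f≋ j =
    trans (pullback-cong {A} {A} {f} (λ _ _ → refl) f≋ j)
    (trans (pullback-· A k (l ⊙ m) j) (*-congˡ (pullback-⊙ A l m j)))

  DoubleLine-pullback : ∀ (B : GL₃) {f} → DoubleLine f → DoubleLine (pullback (GL₃.matrix B) f)
  DoubleLine-pullback B {f} (k , l , f≋) = k , l ·ᴹ matrix , pullback-·-⊙ matrix k l l {f} f≋
    where open GL₃ B

  RealLinePair-pullback : ∀ (B : GL₃) {f} → RealLinePair f → RealLinePair (pullback (GL₃.matrix B) f)
  RealLinePair-pullback B {f} (l , m , l∦m , f≋) =
    l ·ᴹ matrix , m ·ᴹ matrix , l∦m ∘ ·ᴹ-cancel-∝ matrix matrix⁻¹ inverseʳ ,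
    λ j → trans (pullback-cong {matrix} {matrix} {f} (λ _ _ → refl) f≋ j) (pullback-⊙ matrix l m j)
    where open GL₃ B

  -- The inverse substitution recovers f from its pullback and multiplies Δ by a square, so a zero
  -- of Δ at the pullback would pass back to f.
  Nonsingular-pullback : ∀ (B : GL₃) {f} → Nonsingular f → Nonsingular (pullback (GL₃.matrix B) f)
  Nonsingular-pullback B {f} Δf≉0 ΔBf≈0 = Δf≉0 (begin
    Δ f                                      ≈⟨ Δ-cong (pullback-inverse matrix matrix⁻¹ inverseʳ f) ⟨
    Δ (pullback matrix⁻¹ Bf)                 ≈⟨ Δ-pullback matrix⁻¹ Bf ⟩
    det matrix⁻¹ * det matrix⁻¹ * Δ Bf       ≈⟨ *-congˡ ΔBf≈0 ⟩
    det matrix⁻¹ * det matrix⁻¹ * 0#         ≈⟨ zeroʳ _ ⟩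
    0#                                       ∎)
    where
    open GL₃ B
    Bf = pullback matrix f
    open import Relation.Binary.Reasoning.Setoid setoid

  Singular-∝ : ∀ {f g} → f ∝ g → Δ f ≈ 0# → Δ g ≈ 0#
  Singular-∝ {f} {g} f∝g Δf≈0 with ∝-sym {u = f} f∝g
  ... | k , _ , g≋kf = trans (Δ-cong g≋kf) (trans (Δ-· k f) (trans (*-congˡ Δf≈0) (zeroʳ _)))

-- Normal forms of the double lines, real line pairs and nonsingular conics of the net.

module NetForms (F : Field c ℓ) (_≟_ : Decidable (Field._≈_ F)) where
  open Functional using (_∷_; [])
  open Field F
  open Coordinates F
  open PullbackProperties F
  open Containment F using (IsNet)
  open Counting F
  open FormClasses F
  open FieldProperties F
  open IntegerCoefficients commutativeRing using (solve; _:=_; _:*_; _:+_; _:-_; :-_; con)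
  open import Algebra.Properties.Ring ring using (-‿distribʳ-*)
  open import Algebra.Properties.Group +-group
    using (inverseʳ-unique) renaming (x∙y⁻¹≈ε⇒x≈y to x-y≈0⇒x≈y)
  open import Relation.Binary.Reasoning.Setoid setoid

  net-cong : ∀ {b b′ c c′ d d′ e e′} → b ≈ b′ → c ≈ c′ → d ≈ d′ → e ≈ e′ →
             net b c d e ≋ net b′ c′ d′ e′
  net-cong b≈ c≈ d≈ e≈ = λ where
    0F → refl
    1F → b≈
    2F → c≈
    3F → -‿cong c≈
    4F → d≈
    5F → e≈

  IsNet⇒≋net : ∀ {f} → IsNet f → f ≋ net (f 1F) (f 2F) (f 4F) (f 5F)
  IsNet⇒≋net (f₀≈0 , f₂+f₃≈0) = λ where
    0F → f₀≈0
    1F → refl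
    2F → refl
    3F → inverseʳ-unique _ _ f₂+f₃≈0
    4F → refl
    5F → refl

  net-scale : ∀ {k k⁻¹} → k * k⁻¹ ≈ 1# → ∀ b c d e →
              net b c d e ∝ net (k⁻¹ * b) (k⁻¹ * c) (k⁻¹ * d) (k⁻¹ * e)
  net-scale {k} {k⁻¹} kk⁻¹≈1 b c d e = k , k≉0 , λ where
      0F → sym (zeroʳ k)
      1F → cancel b
      2F → cancel c
      3F → trans (-‿cong (cancel c)) (-‿distribʳ-* k (k⁻¹ * c))
      4F → cancel d
      5F → cancel e
    where
    cancel : ∀ x → x ≈ k * (k⁻¹ * x)
    cancel x = sym (trans (sym (*-assoc _ _ _)) (trans (*-congʳ kk⁻¹≈1) (*-identityˡ x)))
    k≉0 : ¬ k ≈ 0#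
    k≉0 k≈0 = 1≉0 (trans (sym kk⁻¹≈1) (trans (*-congʳ k≈0) (zeroˡ _)))

  data Reduced (f : QuadraticForm) : Set (c ⊔ ℓ) where
    lead₁ : ∀ c d e → f ∝ net 1# c d e → Reduced f
    lead₂ : ∀ d e → f ∝ net 0# 1# d e → Reduced f
    lead₃ : ∀ e → f ∝ net 0# 0# 1# e → Reduced f
    lead₄ : f ∝ net 0# 0# 0# 1# → Reduced f

  reduce : ∀ f → ¬ IsZero f → IsNet f → Reduced f
  reduce f f≉0 f-net = go (f 1F ≟ 0#) (f 2F ≟ 0#) (f 4F ≟ 0#) (f 5F ≟ 0#)
    where
    -- Here k is the first nonzero coefficient, and b, c, d, e are the coefficients divided by it.
    f∝ : ∀ {k k⁻¹ b c d e} → k * k⁻¹ ≈ 1# → k⁻¹ * f 1F ≈ b → k⁻¹ * f 2F ≈ c →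
         k⁻¹ * f 4F ≈ d → k⁻¹ * f 5F ≈ e → f ∝ net b c d e
    f∝ kk⁻¹≈1 b≈ c≈ d≈ e≈ =
      ∝-trans (≋⇒∝ (IsNet⇒≋net {f} f-net))
      (∝-trans (net-scale kk⁻¹≈1 _ _ _ _) (≋⇒∝ (net-cong b≈ c≈ d≈ e≈)))
    pivot : ∀ {k k⁻¹} → k * k⁻¹ ≈ 1# → k⁻¹ * k ≈ 1#
    pivot = trans (*-comm _ _)
    vanish : ∀ {k x} → x ≈ 0# → k * x ≈ 0#
    vanish x≈0 = trans (*-congˡ x≈0) (zeroʳ _)
    go : Dec (f 1F ≈ 0#) → Dec (f 2F ≈ 0#) → Dec (f 4F ≈ 0#) → Dec (f 5F ≈ 0#) → Reduced f
    go (no b≉0)  _         _         _         =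
      let k⁻¹ , kk⁻¹≈1 = inverse _ b≉0
      in lead₁ _ _ _ (f∝ kk⁻¹≈1 (pivot kk⁻¹≈1) refl refl refl)
    go (yes b≈0) (no c≉0)  _         _         =
      let k⁻¹ , kk⁻¹≈1 = inverse _ c≉0
      in lead₂ _ _ (f∝ kk⁻¹≈1 (vanish b≈0) (pivot kk⁻¹≈1) refl refl)
    go (yes b≈0) (yes c≈0) (no d≉0)  _         =
      let k⁻¹ , kk⁻¹≈1 = inverse _ d≉0
      in lead₃ _ (f∝ kk⁻¹≈1 (vanish b≈0) (vanish c≈0) (pivot kk⁻¹≈1) refl)
    go (yes b≈0) (yes c≈0) (yes d≈0) (no e≉0)  =
      let k⁻¹ , kk⁻¹≈1 = inverse _ e≉0
      in lead₄ (f∝ kk⁻¹≈1 (vanish b≈0) (vanish c≈0) (vanish d≈0) (pivot kk⁻¹≈1))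
    go (yes b≈0) (yes c≈0) (yes d≈0) (yes e≈0) = contradiction
      (λ i → trans (IsNet⇒≋net {f} f-net i) (trans (net-cong b≈0 c≈0 d≈0 e≈0 i) (net-0 i))) f≉0
      where
      net-0 : IsZero (net 0# 0# 0# 0#)
      net-0 = λ where
        0F → refl
        1F → refl
        2F → refl
        3F → trans (sym (+-identityˡ _)) (-‿inverseʳ 0#)
        4F → refl
        5F → refl

  -- Comparing the entries at `i` forces the factor of proportionality to be 1. Injectivity of the
  -- normal forms rests on this and on `lead-mismatch`.
  same-lead : ∀ {n} {u v : Vector Carrier n} i → u i ≈ 1# → v i ≈ 1# → u ∝ v → u ≋ v
  same-lead i uᵢ≈1 vᵢ≈1 (k , _ , u≋kv) j = trans (u≋kv j) (trans (*-congʳ k≈1) (*-identityˡ _))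
    where
    k≈1 : k ≈ 1#
    k≈1 = begin
      k        ≈⟨ *-identityʳ k ⟨
      k * 1#   ≈⟨ *-congˡ vᵢ≈1 ⟨
      k * _    ≈⟨ u≋kv i ⟨
      _        ≈⟨ uᵢ≈1 ⟩
      1#       ∎

  lead-mismatch : ∀ {n} {u v : Vector Carrier n} i → u i ≈ 1# → v i ≈ 0# → ¬ u ∝ v
  lead-mismatch i uᵢ≈1 vᵢ≈0 u∝v = 1≉0 (trans (sym uᵢ≈1) (∝-IsZero i (∝-sym u∝v) vᵢ≈0))

  x≈0⇒x*y+z*x≈0 : ∀ {x y z} → x ≈ 0# → x * y + z * x ≈ 0#
  x≈0⇒x*y+z*x≈0 x≈0 = trans (x≈0⇒x*y+z≈z x≈0) (trans (*-congˡ x≈0) (zeroʳ _))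

  -- If k l² is in the net, then k l₀² = 0 gives l₀ = 0, so a₀₁ = a₀₂ = 0. Then a₁₁ = 0 by the net
  -- condition, which gives l₁ = 0 and a₁₂ = 0. Only X₂² remains.
  doubleLines : NormalForms DoubleLine (≡.setoid (Fin 1))
  doubleLines = record
    { form       = λ _ → X₂²
    ; cong       = λ _ _ → refl
    ; injective  = λ { {0F} {0F} _ → ≡.refl }
    ; nonzero    = λ _ X₂²≈0 → 1≉0 (X₂²≈0 5F)
    ; isNet      = λ _ → refl , -‿inverseʳ _
    ; inP        = λ _ → 1# , X₂ , λ where
        0F → solve 0 (con (+ 0) := con (+ 1) :* (con (+ 0) :* con (+ 0))) refl
        1F → solve 0 (con (+ 0) := con (+ 1) :* (con (+ 0) :* con (+ 0) :+ con (+ 0) :* con (+ 0))) refl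
        2F → solve 0 (con (+ 0) := con (+ 1) :* (con (+ 0) :* con (+ 1) :+ con (+ 1) :* con (+ 0))) refl
        3F → solve 0 (:- con (+ 0) := con (+ 1) :* (con (+ 0) :* con (+ 0))) refl
        4F → solve 0 (con (+ 0) := con (+ 1) :* (con (+ 0) :* con (+ 1) :+ con (+ 1) :* con (+ 0))) refl
        5F → solve 0 (con (+ 1) := con (+ 1) :* (con (+ 1) :* con (+ 1))) refl
    ; surjective = λ f f≉0 f-net (k , l , f≋) → 0F , surjective f f≉0 f-net k l f≋
    }
    where
    X₂² = net 0# 0# 0# 1#
    X₂ : LinearForm
    X₂ = 0# ∷ 0# ∷ 1# ∷ []
    surjective : ∀ f → ¬ IsZero f → IsNet f → ∀ k l → f ≋ k · (l ⊙ l) → f ∝ X₂²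
    surjective f f≉0 f-net@(f₀≈0 , f₂+f₃≈0) k l f≋ = go (reduce f f≉0 f-net)
      where
      k≉0 : ¬ k ≈ 0#
      k≉0 k≈0 = f≉0 λ i → trans (f≋ i) (trans (*-congʳ k≈0) (zeroˡ _))
      f≈0 : ∀ i → (l ⊙ l) i ≈ 0# → f i ≈ 0#
      f≈0 i lᵢ≈0 = trans (f≋ i) (trans (*-congˡ lᵢ≈0) (zeroʳ k))
      l₀≈0 : l 0F ≈ 0#
      l₀≈0 = x*x≈0⇒x≈0 _≟_ (x*y≈0⇒y≈0 k≉0 (trans (sym (f≋ 0F)) f₀≈0))
      f₁≈0 : f 1F ≈ 0#
      f₁≈0 = f≈0 1F (x≈0⇒x*y+z*x≈0 l₀≈0)
      f₂≈0 : f 2F ≈ 0#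
      f₂≈0 = f≈0 2F (x≈0⇒x*y+z*x≈0 l₀≈0)
      f₃≈0 : f 3F ≈ 0#
      f₃≈0 = trans (sym (+-identityˡ _)) (trans (+-congʳ (sym f₂≈0)) f₂+f₃≈0)
      l₁≈0 : l 1F ≈ 0#
      l₁≈0 = x*x≈0⇒x≈0 _≟_ (x*y≈0⇒y≈0 k≉0 (trans (sym (f≋ 3F)) f₃≈0))
      f₄≈0 : f 4F ≈ 0#
      f₄≈0 = f≈0 4F (x≈0⇒x*y+z*x≈0 l₁≈0)
      go : Reduced f → f ∝ X₂²
      go (lead₁ _ _ _ f∝) = contradiction (∝-sym {u = f} f∝) (lead-mismatch 1F refl f₁≈0)
      go (lead₂ _ _ f∝) = contradiction (∝-sym {u = f} f∝) (lead-mismatch 2F refl f₂≈0)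
      go (lead₃ _ f∝) = contradiction (∝-sym {u = f} f∝) (lead-mismatch 4F refl f₄≈0)
      go (lead₄ f∝) = f∝

  -- The value of e that makes net 1# c d e singular.
  e₀ : Carrier → Carrier → Carrier
  e₀ c d = c * d + c * c * c

  e₀-cong : ∀ {c c′ d d′} → c ≈ c′ → d ≈ d′ → e₀ c d ≈ e₀ c′ d′
  e₀-cong c≈ d≈ = +-cong (*-cong c≈ d≈) (*-cong (*-cong c≈ c≈) c≈)

  -- The first summand gives the q² singular conics with b = 1, the second the q conics X₂ (X₁ + e
  -- X₂).
  productForm : Carrier × Carrier ⊎ Carrier → QuadraticForm
  productForm (inj₁ (c , d)) = net 1# c d (e₀ c d)
  productForm (inj₂ e)       = net 0# 0# 1# e

  realLinePairs : NormalForms RealLinePair ((setoid ×ₛ setoid) ⊎ₛ setoid)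
  realLinePairs = record
    { form       = productForm
    ; cong       = λ where
        (inj₁ (c≈ , d≈)) → net-cong refl c≈ d≈ (e₀-cong c≈ d≈)
        (inj₂ e≈)        → net-cong refl refl refl e≈
    ; injective  = injective _ _
    ; nonzero    = λ where
        (inj₁ _) t≈0 → 1≉0 (t≈0 1F)
        (inj₂ _) t≈0 → 1≉0 (t≈0 4F)
    ; isNet      = λ where
        (inj₁ _) → refl , -‿inverseʳ _
        (inj₂ _) → refl , -‿inverseʳ _
    ; inP        = λ where
        -- X₀ occurs only in X₀ (X₁ + c X₂), so X₁ + c X₂ has to be a factor. It divides the
        -- remaining - c X₁² + d X₁X₂ + e X₂² exactly when e = c d + c³, with quotient - c X₁ + (d +
        -- c²) X₂.
        (inj₁ (c , d)) → 0# ∷ 1# ∷ c ∷ [] , 1# ∷ - c ∷ d + c * c ∷ [] ,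
          (λ l∝m → lead-mismatch 0F refl refl (∝-sym l∝m)) , λ where
          0F → solve 0 (con (+ 0) := con (+ 0) :* con (+ 1)) refl
          1F → solve 1 (λ c → con (+ 1) := con (+ 0) :* :- c :+ con (+ 1) :* con (+ 1)) refl c
          2F → solve 2 (λ c d → c := con (+ 0) :* (d :+ c :* c) :+ c :* con (+ 1)) refl c d
          3F → solve 1 (λ c → :- c := con (+ 1) :* :- c) refl c
          4F → solve 2 (λ c d → d := con (+ 1) :* (d :+ c :* c) :+ c :* :- c) refl c d
          5F → solve 2 (λ c d → c :* d :+ c :* c :* c := c :* (d :+ c :* c)) refl c d
        (inj₂ e) → 0# ∷ 0# ∷ 1# ∷ [] , 0# ∷ 1# ∷ e ∷ [] ,
          (λ l∝m → lead-mismatch 1F refl refl (∝-sym l∝m)) , λ where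
          0F → solve 0 (con (+ 0) := con (+ 0) :* con (+ 0)) refl
          1F → solve 0 (con (+ 0) := con (+ 0) :* con (+ 1) :+ con (+ 0) :* con (+ 0)) refl
          2F → solve 1 (λ e → con (+ 0) := con (+ 0) :* e :+ con (+ 1) :* con (+ 0)) refl e
          3F → solve 0 (:- con (+ 0) := con (+ 0) :* con (+ 1)) refl
          4F → solve 1 (λ e → con (+ 1) := con (+ 0) :* e :+ con (+ 1) :* con (+ 1)) refl e
          5F → solve 1 (λ e → e := con (+ 1) :* e) refl e
    ; surjective = λ f f≉0 f-net (l , m , l∦m , f≋) → surjective f l m l∦m f≋ (reduce f f≉0 f-net)
    }
    where
    injective : ∀ t u → productForm t ∝ productForm u →
                Setoid._≈_ ((setoid ×ₛ setoid) ⊎ₛ setoid) t u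
    injective (inj₁ _) (inj₁ _) t∝u = let t≋u = same-lead 1F refl refl t∝u in inj₁ (t≋u 2F , t≋u 4F)
    injective (inj₁ _) (inj₂ _) t∝u = contradiction t∝u (lead-mismatch 1F refl refl)
    injective (inj₂ _) (inj₁ _) t∝u = contradiction (∝-sym t∝u) (lead-mismatch 1F refl refl)
    injective (inj₂ _) (inj₂ _) t∝u = inj₂ (same-lead 4F refl refl t∝u 5F)

    -- A product of linear forms has Δ = 0. This determines e when b = 1 and excludes b = 0, c = 1,
    -- where Δ = 1. The form X₂² is excluded because its factors are proportional.
    surjective : ∀ f l m → ¬ l ∝ m → f ≋ l ⊙ m → Reduced f → ∃ λ t → f ∝ productForm t
    surjective f l m l∦m f≋ = go
      where
      Δ≈0 : ∀ {g} → f ∝ g → Δ g ≈ 0#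
      Δ≈0 f∝g = Singular-∝ f∝g (trans (Δ-cong f≋) (Δ-⊙ l m))
      go : Reduced f → ∃ λ t → f ∝ productForm t
      go (lead₁ c d e f∝) = inj₁ (c , d) , ∝-trans f∝ (≋⇒∝ (net-cong refl refl refl
        (sym (x-y≈0⇒x≈y _ _ (trans (sym (Δ-net₁ c d e)) (Δ≈0 f∝))))))
      go (lead₂ d e f∝) = contradiction (trans (sym (Δ-net₂ d e)) (Δ≈0 f∝)) 1≉0
      go (lead₃ e f∝) = inj₂ e , f∝
      go (lead₄ f∝) = contradiction (l⊙m∝X₂²⇒l∝m _≟_ lm≈0 lm₅≉0) l∦m
        where
        lm∝ : net 0# 0# 0# 1# ∝ l ⊙ m
        lm∝ = ∝-trans (∝-sym f∝) (≋⇒∝ f≋)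
        lm≈0 : ∀ i → ¬ i ≡ 5F → (l ⊙ m) i ≈ 0#
        lm≈0 0F _ = ∝-IsZero 0F lm∝ refl
        lm≈0 1F _ = ∝-IsZero 1F lm∝ refl
        lm≈0 2F _ = ∝-IsZero 2F lm∝ refl
        lm≈0 3F _ = ∝-IsZero 3F lm∝ (solve 0 (:- con (+ 0) := con (+ 0)) refl)
        lm≈0 4F _ = ∝-IsZero 4F lm∝ refl
        lm≈0 5F 5≢5 = contradiction ≡.refl 5≢5
        lm₅≉0 : ¬ (l ⊙ m) 5F ≈ 0#
        lm₅≉0 lm₅≈0 = 1≉0 (∝-IsZero 5F (∝-sym lm∝) lm₅≈0)

  -- A value z ≠ 0 is Δ; the forms with b = 0 take the place left free at z = 0.
  nonsingularForm : ∀ x y z → Dec (z ≈ 0#) → QuadraticForm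
  nonsingularForm x y z (no _)  = net 1# x y (e₀ x y - z)
  nonsingularForm x y z (yes _) = net 0# 1# x y

  -- For b = 1 the coefficient e and the value z = Δ are related by z = e₀ - e. This map is an
  -- involution, so z can replace e as a parameter.
  x-[x-y]≈y : ∀ x y → x - (x - y) ≈ y
  x-[x-y]≈y = solve 2 (λ x y → x :- (x :- y) := y) refl

  nonsingulars : NormalForms Nonsingular (setoid ×ₛ (setoid ×ₛ setoid))
  nonsingulars = record
    -- The decision on z is passed as an argument, and the lemmas below hold for arbitrary
    -- decisions, so they can split into cases without unfolding `_≟_`.
    { form       = λ (x , y , z) → nonsingularForm x y z (z ≟ 0#)
    ; cong       = λ (x≈ , y≈ , z≈) → cong x≈ y≈ z≈ (_ ≟ 0#) (_ ≟ 0#)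
    ; injective  = injective _ _ _ _ _ _ (_ ≟ 0#) (_ ≟ 0#)
    ; nonzero    = λ (x , y , z) → nonzero x y z (z ≟ 0#)
    ; isNet      = λ (x , y , z) → isNet x y z (z ≟ 0#)
    ; inP        = λ (x , y , z) → nonsingular x y z (z ≟ 0#)
    ; surjective = λ f f≉0 f-net Δf≉0 → surjective f Δf≉0 (reduce f f≉0 f-net)
    }
    where
    cong : ∀ {x x′ y y′ z z′} → x ≈ x′ → y ≈ y′ → z ≈ z′ → ∀ z? z′? →
           nonsingularForm x y z z? ≋ nonsingularForm x′ y′ z′ z′?
    cong x≈ y≈ z≈ (no _)    (no _)     = net-cong refl x≈ y≈ (+-cong (e₀-cong x≈ y≈) (-‿cong z≈))
    cong x≈ y≈ z≈ (yes _)   (yes _)    = net-cong refl refl x≈ y≈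
    cong x≈ y≈ z≈ (no z≉0)  (yes z′≈0) = contradiction (trans z≈ z′≈0) z≉0
    cong x≈ y≈ z≈ (yes z≈0) (no z′≉0)  = contradiction (trans (sym z≈) z≈0) z′≉0

    injective : ∀ x y z x′ y′ z′ z? z′? →
                nonsingularForm x y z z? ∝ nonsingularForm x′ y′ z′ z′? → x ≈ x′ × y ≈ y′ × z ≈ z′
    injective x y z x′ y′ z′ (no _) (no _) t∝u = t≋u 2F , t≋u 4F , (begin
        z                           ≈⟨ x-[x-y]≈y _ z ⟨
        e₀ x y - (e₀ x y - z)       ≈⟨ +-cong (e₀-cong (t≋u 2F) (t≋u 4F)) (-‿cong (t≋u 5F)) ⟩
        e₀ x′ y′ - (e₀ x′ y′ - z′)  ≈⟨ x-[x-y]≈y _ z′ ⟩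
        z′                          ∎)
      where
      t≋u = same-lead 1F refl refl t∝u
    injective x y z x′ y′ z′ (yes z≈0) (yes z′≈0) t∝u =
      let t≋u = same-lead 2F refl refl t∝u in t≋u 4F , t≋u 5F , trans z≈0 (sym z′≈0)
    injective x y z x′ y′ z′ (no _) (yes _) t∝u = contradiction t∝u (lead-mismatch 1F refl refl)
    injective x y z x′ y′ z′ (yes _) (no _) t∝u =
      contradiction (∝-sym t∝u) (lead-mismatch 1F refl refl)

    nonzero : ∀ x y z z? → ¬ IsZero (nonsingularForm x y z z?)
    nonzero x y z (no _)  t≈0 = 1≉0 (t≈0 1F)
    nonzero x y z (yes _) t≈0 = 1≉0 (t≈0 2F)

    isNet : ∀ x y z z? → IsNet (nonsingularForm x y z z?)
    isNet x y z (no _)  = refl , -‿inverseʳ _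
    isNet x y z (yes _) = refl , -‿inverseʳ _

    nonsingular : ∀ x y z z? → Nonsingular (nonsingularForm x y z z?)
    nonsingular x y z (no z≉0) Δ≈0 = z≉0
      (trans (sym (x-[x-y]≈y _ z)) (trans (sym (Δ-net₁ x y _)) Δ≈0))
    nonsingular x y z (yes _)  Δ≈0 = 1≉0 (trans (sym (Δ-net₂ x y)) Δ≈0)

    nonsingularForm-no : ∀ {x y z} → ¬ z ≈ 0# → ∀ z? →
                         net 1# x y (e₀ x y - z) ≋ nonsingularForm x y z z?
    nonsingularForm-no z≉0 (no _)    = λ _ → refl
    nonsingularForm-no z≉0 (yes z≈0) = contradiction z≈0 z≉0

    nonsingularForm-yes : ∀ {x y z} → z ≈ 0# → ∀ z? → net 0# 1# x y ≋ nonsingularForm x y z z?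
    nonsingularForm-yes z≈0 (no z≉0) = contradiction z≈0 z≉0
    nonsingularForm-yes z≈0 (yes _)  = λ _ → refl

    surjective : ∀ f → Nonsingular f → Reduced f →
                 ∃ λ ((x , y , z) : Carrier × Carrier × Carrier) → f ∝ nonsingularForm x y z (z ≟ 0#)
    surjective f Δf≉0 (lead₁ c d e f∝) = (c , d , z) ,
      ∝-trans f∝ (≋⇒∝ λ i → trans (net-cong refl refl refl (sym (x-[x-y]≈y _ e)) i)
                                  (nonsingularForm-no z≉0 (z ≟ 0#) i))
      where
      z = e₀ c d - e
      z≉0 : ¬ z ≈ 0#
      z≉0 z≈0 = Δf≉0 (Singular-∝ (∝-sym f∝) (trans (Δ-net₁ c d e) z≈0))
    -- The parameter z = 0 selects the family with b = 0 and c = 1, where x and y stand for the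
    -- coefficients d and e.
    surjective f Δf≉0 (lead₂ d e f∝) = (d , e , 0#) ,
      ∝-trans f∝ (≋⇒∝ (nonsingularForm-yes refl (0# ≟ 0#)))
    surjective f Δf≉0 (lead₃ e f∝) = contradiction (Singular-∝ (∝-sym f∝) (Δ-net₃ 1# e)) Δf≉0
    surjective f Δf≉0 (lead₄ f∝)   = contradiction (Singular-∝ (∝-sym f∝) (Δ-net₃ 0# 1#)) Δf≉0

-- No pair of conjugate imaginary lines lies in the net.

module ConjugateLinePairs {q : ℕ} (F : Field c ℓ) (_≟_ : Decidable (Field._≈_ F))
                          (E/F : QuadraticExtension F q c′ ℓ′) where
  open Hyperplanes F E/F using (Conjugate; 𝓗₂ᵢ)
  open QuadraticExtension E/F using (E; order; ι; isHomomorphism)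
  open Projective F using (coord)
  open SymmetricMatrices F using (GL₃)
  open Containment F using (IsNet)
  private
    module F where
      open Field F public
      open Coordinates F public
      open PullbackProperties F public
      open InvertibleSubstitutions F public
    module E where
      open Field E public
      open Coordinates E public
      open SymmetricMatrices E public
      open PullbackProperties E public
      open InvertibleSubstitutions E public
      open FieldProperties E public
      open FormClasses E public
    module ι where
      open HomomorphismProperties F E isHomomorphism public
      open IsRingHomomorphism isHomomorphism public
  open import Relation.Binary.Reasoning.Setoid E.setoid

  _≟ᴱ_ : Decidable E._≈_
  _≟ᴱ_ = cardinality⇒decidable order

  module _ (A : GL₃) where
    open GL₃ A

    ιA·ιA⁻¹≈1 : ι.mapᴹ matrix E.*ᴹ ι.mapᴹ matrix⁻¹ E.≈ᴹ E.1ᴹ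
    ιA·ιA⁻¹≈1 i j = E.trans (E.sym (ι.*ᴹ-homo matrix matrix⁻¹ i j))
                    (E.trans (ι.⟦⟧-cong (inverseʳ i j)) (ι.1ᴹ-homo i j))

    -- The entries of the substitution come from F and are fixed by σ, so the same σ conjugates the
    -- transformed linear forms.
    Conjugate-·ᴹ : ∀ l m → Conjugate l m → Conjugate (l E.·ᴹ ι.mapᴹ matrix) (m E.·ᴹ ι.mapᴹ matrix)
    Conjugate-·ᴹ l m (σ , σ-iso , σ-fixes , m≋σl) = σ , σ-iso , σ-fixes , λ j → begin
      (m E.·ᴹ ι.mapᴹ matrix) j                  ≈⟨ E.·ᴹ-cong {m} {map σ l} m≋σl
                                                     (λ i j → E.sym (σ-fixes (matrix i j))) j ⟩
      (map σ l E.·ᴹ σ.mapᴹ (ι.mapᴹ matrix)) j   ≈⟨ σ.·ᴹ-homo l (ι.mapᴹ matrix) j ⟨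
      σ ((l E.·ᴹ ι.mapᴹ matrix) j)              ∎
      where module σ = HomomorphismProperties E E (IsRingIsomorphism.isRingHomomorphism σ-iso)

    pullback-conjugates : ∀ f k l m → map ι f E.≋ ι k E.· (l E.⊙ m) →
      map ι (F.pullback matrix f) E.≋ ι k E.· ((l E.·ᴹ ι.mapᴹ matrix) E.⊙ (m E.·ᴹ ι.mapᴹ matrix))
    pullback-conjugates f k l m ιf≋ j =
      E.trans (ι.pullback-homo matrix f j) (E.pullback-·-⊙ (ι.mapᴹ matrix) (ι k) l m ιf≋ j)

  ιx≈0⇒x≈0 : ∀ {x} → ι x E.≈ E.0# → x F.≈ F.0#
  ιx≈0⇒x≈0 {x} ιx≈0 = decidable-stable (x ≟ F.0#) λ x≉0 → ι.x≉0⇒fx≉0 x≉0 ιx≈0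

  -- A vanishing product makes x or σ(x) zero, and each implies the other because σ is injective and
  -- preserves 0.
  x*σx≈0⇒x≈0 : ∀ {σ} → IsRingIsomorphism E.rawRing E.rawRing σ → ∀ {x y} → y E.≈ σ x →
               x E.* y E.≈ E.0# → x E.≈ E.0# × y E.≈ E.0#
  x*σx≈0⇒x≈0 {σ} σ-iso {x} {y} y≈σx xy≈0 = x≈0 , E.trans y≈σx (E.trans (⟦⟧-cong x≈0) 0#-homo)
    where
    open IsRingIsomorphism σ-iso
    x≈0 : x E.≈ E.0#
    x≈0 = [ id , (λ y≈0 → injective (E.trans (E.sym y≈σx) (E.trans y≈0 (E.sym 0#-homo)))) ]′
            (E.x*y≈0⇒x≈0∨y≈0 _≟ᴱ_ xy≈0)

  net-conjugates-∝ : ∀ f k l m → ¬ F.IsZero f → IsNet f → map ι f E.≋ ι k E.· (l E.⊙ m) →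
                     Conjugate l m → l E.∝ m
  net-conjugates-∝ f k l m f≉0 (f₀≈0 , f₂+f₃≈0) ιf≋ (σ , σ-iso , _ , m≋σl) =
    -- All coefficients of l m other than that of X₂² vanish. If that one vanished too, f would be
    -- zero because ι reflects zero.
    E.l⊙m∝X₂²⇒l∝m _≟ᴱ_ lm≈0 λ lm₅≈0 → f≉0 λ where
      0F → f≈0 0F (lm≈0 0F λ ())
      1F → f≈0 1F (lm≈0 1F λ ())
      2F → f≈0 2F (lm≈0 2F λ ())
      3F → f≈0 3F (lm≈0 3F λ ())
      4F → f≈0 4F (lm≈0 4F λ ())
      5F → f≈0 5F lm₅≈0
    where
    f≈0 : ∀ i → (l E.⊙ m) i E.≈ E.0# → f i F.≈ F.0#
    f≈0 i lmᵢ≈0 = ιx≈0⇒x≈0 (E.trans (ιf≋ i) (E.trans (E.*-congˡ lmᵢ≈0) (E.zeroʳ _)))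
    ιk≉0 : ¬ ι k E.≈ E.0#
    ιk≉0 ιk≈0 = f≉0 λ i → ιx≈0⇒x≈0 (E.trans (ιf≋ i) (E.trans (E.*-congʳ ιk≈0) (E.zeroˡ _)))
    lmᵢ≈0 : ∀ i → f i F.≈ F.0# → (l E.⊙ m) i E.≈ E.0#
    lmᵢ≈0 i fᵢ≈0 = E.x*y≈0⇒y≈0 ιk≉0 (E.trans (E.sym (ιf≋ i)) (E.trans (ι.⟦⟧-cong fᵢ≈0) ι.0#-homo))
    polar≈0 : ∀ {w x y z} → w E.≈ E.0# → z E.≈ E.0# → w E.* x E.+ y E.* z E.≈ E.0#
    polar≈0 w≈0 z≈0 = E.trans (E.x≈0⇒x*y+z≈z w≈0) (E.trans (E.*-congˡ z≈0) (E.zeroʳ _))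
    l₀m₀ : l 0F E.≈ E.0# × m 0F E.≈ E.0#
    l₀m₀ = x*σx≈0⇒x≈0 σ-iso (m≋σl 0F) (lmᵢ≈0 0F f₀≈0)
    lm₂≈0 : (l E.⊙ m) 2F E.≈ E.0#
    lm₂≈0 = polar≈0 (proj₁ l₀m₀) (proj₂ l₀m₀)
    f₃≈0 : f 3F F.≈ F.0#
    f₃≈0 = F.trans (F.sym (F.+-identityˡ _)) (F.trans (F.+-congʳ (F.sym (f≈0 2F lm₂≈0))) f₂+f₃≈0)
    l₁m₁ : l 1F E.≈ E.0# × m 1F E.≈ E.0#
    l₁m₁ = x*σx≈0⇒x≈0 σ-iso (m≋σl 1F) (lmᵢ≈0 3F f₃≈0)
    lm≈0 : ∀ i → ¬ i ≡ 5F → (l E.⊙ m) i E.≈ E.0#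
    lm≈0 0F _ = lmᵢ≈0 0F f₀≈0
    lm≈0 1F _ = polar≈0 (proj₁ l₀m₀) (proj₂ l₀m₀)
    lm≈0 2F _ = lm₂≈0
    lm≈0 3F _ = lmᵢ≈0 3F f₃≈0
    lm≈0 4F _ = polar≈0 (proj₁ l₁m₁) (proj₂ l₁m₁)
    lm≈0 5F 5≢5 = contradiction ≡.refl 5≢5

  -- In the net the transformed factors would be proportional. The matrix is invertible over E too,
  -- so the original factors would be proportional as well.
  𝓗₂ᵢ-pullback-notNet : ∀ (A : GL₃) H → 𝓗₂ᵢ H → ¬ IsNet (F.pullback (GL₃.matrix A) (coord H))
  𝓗₂ᵢ-pullback-notNet A H (k , l , m , conj , l∦m , ιH≋) AH-net =
    l∦m (E.·ᴹ-cancel-∝ (ι.mapᴹ matrix) (ι.mapᴹ matrix⁻¹) (ιA·ιA⁻¹≈1 A)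
      (net-conjugates-∝ (F.pullback matrix (coord H)) k
        (l E.·ᴹ ι.mapᴹ matrix) (m E.·ᴹ ι.mapᴹ matrix)
        (F.pullback-nonzero matrix matrix⁻¹ inverseʳ (Projective.nonzero H)) AH-net
        (pullback-conjugates A (coord H) k l m ιH≋) (Conjugate-·ᴹ A l m conj)))
    where open GL₃ A

-- The hyperplane-orbit distribution of a line in `o₉`.

open import Data.Nat.Base using (_+_; _^_)
open import Data.Vec.Base using (_∷_; [])
open Projective using (Line)
open SymmetricMatrices using (o₉)
open Hyperplanes using (HasOD₄)

lemma4p7 : ∀ {c ℓ c′ ℓ′} (q : ℕ) → IsPrimePower q →
    (F : Field c ℓ) → HasOrder F q →
    (E/F : QuadraticExtension F q c′ ℓ′) →
    (L : Line F 5) → o₉ F L →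
    HasOD₄ F E/F L (1 ∷ q ^ 2 + q ∷ 0 ∷ q ^ 3 ∷ [])
lemma4p7 q _ F F≅q E/F L (A , L≐Aℓ₉) =
    count DoubleLine-pullback doubleLines (Identity.inverse _)
  -- The parameter set has q * q + q elements, while `q ^ 2` unfolds to q * (q * 1). The same
  -- correction occurs below for `q ^ 3`.
  , ≡.subst (CountHyperplanes _) (≡.cong (λ n → q ℕ.* n ℕ.+ q) (≡.sym (ℕ.*-identityʳ q)))
      (count RealLinePair-pullback realLinePairs (⊎-cardinality (×-cardinality F≅q F≅q) F≅q))
  , empty-cardinality (λ (H , H∈𝓗₂ᵢ , L⊆H) →
      𝓗₂ᵢ-pullback-notNet A H H∈𝓗₂ᵢ (Contains⇒IsNet H L⊆H))
  , ≡.subst (CountHyperplanes _) (≡.cong (λ n → q ℕ.* (q ℕ.* n)) (≡.sym (ℕ.*-identityʳ q)))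
      (count Nonsingular-pullback nonsingulars (×-cardinality F≅q (×-cardinality F≅q F≅q)))
  where
  _≟_ : Decidable (Field._≈_ F)
  _≟_ = cardinality⇒decidable F≅q
  open Projective F using (CountHyperplanes)
  open Containment.Translate F _≟_ A L L≐Aℓ₉ using (Contains⇒IsNet)
  open Counting.TranslateCount F _≟_ A L L≐Aℓ₉ using (count)
  open FormClasses F
  open NetForms F _≟_
  open ConjugateLinePairs F _≟_ E/F
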